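{- Let $\mathbb{A}$ be a finite relational structure such that there is a linear Datalog program that decides $\mathrm{CSP}(\mathbb{A})$, and such that $\mathbb{A}$ has polymorphisms $p_0,p_1,\dots,p_n$ forming a chain of $n$ Hagemann–Mitschke terms. Then there exists $r\in\mathbb{N}$ such that the program $\mathcal{S}^{r}_{\mathbb{A}}$ decides $\mathrm{CSP}(\mathbb{A})$.
   Context: A relational structure $\mathbb{A}=(A,\mathcal{R})$ is a finite set $A$ with finitely many relations (basic relations) of positive finite arity. An instance $I=(V,\mathcal{C})$ of $\mathrm{CSP}(\mathbb{A})$ is a finite set $V$ of variables and a set $\mathcal{C}$ of constraints $(\sigma,R)$ with $R$ an $n$-ary basic relation of $\mathbb{A}$ and $\sigma\in V^n$; a solution is a map $f\colon V\to A$ with $f(\sigma)\in R$ for every constraint (applied coordinatewise); $I$ is satisfiable if it has a solution. A polymorphism of $\mathbb{A}$ is an operation on $A$ preserving all basic relations. A chain of Hagemann–Mitschke terms is a sequence of ternary operations $p_0,\dots,p_n$ with $p_0(x,y,z)=x$, $p_i(x,x,y)=p_{i+1}(x,y,y)$ for $i=0,\dots,n-1$, and $p_n(x,y,z)=z$. Datalog: a program consists of rules $R(\rho)\leftarrow S_1(\sigma_1),\dots,S_\ell(\sigma_\ell)$ where $R,S_i$ are predicate symbols and $\rho,\sigma_i$ tuples of program variables; predicates occurring on some left-hand side are IDBs, the program contains a (non-IDB) symbol for each basic relation of $\mathbb{A}$, and some predicates are designated goal predicates. Running a program $P$ on an instance $I=(V,\mathcal C)$: $P(I)\vdash R(\rho)$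 (with $\rho$ a tuple of elements of $V$) holds if $(\rho,R)\in\mathcal C$, or if $P$ has a rule $R(\tau)\leftarrow S_1(\sigma_1),\dots,S_\ell(\sigma_\ell)$ and a map $\omega$ from program variables to $V$ with $\omega(\tau)=\rho$ and $P(I)\vdash S_i(\omega(\sigma_i))$ for all $i$. $P(I)\vdash G$ means $P(I)\vdash R(\rho)$ for some goal predicate $R$ and some $\rho$. $P$ decides $\mathrm{CSP}(\mathbb{A})$ if for every instance $I$, $P(I)\vdash G$ iff $I$ is unsatisfiable. A program is linear if every rule has at most one IDB on its right-hand side. The $r$-ary maximal symmetric Datalog program $\mathcal{S}^r_{\mathbb{A}}$: its IDB predicates are all relations on $A$ of arity at most $r$ (each predicate interpreted as that relation), plus a non-IDB symbol for each basic relation of $\mathbb{A}$ of arity at most $r$. Its rules are all rules that (1) have an IDB on the left and at most one IDB on the right, (2) use only variables from $\{x_1,\dots,x_r\}$, (3) have no atom repeated on the right, (4) are consistent with $\mathbb{A}$, i.e. for every $f\colon\{x_1,\dots,x_r\}\to A$, if $f(\sigma_i)\in S_i$ for all right-hand atoms then $f(\rho)\in R$, and (5) if the right side contains an IDB atom, the rule obtained by exchanging the left atom with that right IDB atom is also consistent with $\mathbb{A}$. Its goal predicates are the empty relations of arity at most $r$. -}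

module Defs where

open import Data.Nat using (ℕ; zero; suc; _≤_; NonZero)
open import Data.Fin using (Fin; toℕ; inject₁; fromℕ)
open import Data.Vec using (Vec; map; zipWith)
open import Data.List using (List; _∷_; [])
open import Data.List.Relation.Unary.All using (All)
open import Data.List.Relation.Unary.Any using (_─_)
open import Data.List.Relation.Unary.Unique.Propositional using (Unique)
open import Data.List.Membership.Propositional using (_∈_)
open import Data.Product using (Σ; _,_; proj₁; proj₂; _×_; ∃)
open import Data.Sum using (_⊎_; inj₁; inj₂)
open import Data.Bool using (Bool; true; false)
open import Data.Empty using (⊥)
open import Data.Unit using (⊤)
open import Relation.Binary.PropositionalEquality using (_≡_)
open import Relation.Nullary using (¬_)

record Structure : Set where
  field
    size      : ℕ
    nRel      : ℕ
    arity     : Fin nRel → ℕ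
    arity-pos : (i : Fin nRel) → NonZero (arity i)
    rel       : (i : Fin nRel) → Vec (Fin size) (arity i) → Bool

module _ (𝔸 : Structure) where
  open Structure 𝔸

  Constraint : ℕ → Set
  Constraint nv = Σ (Fin nRel) (λ i → Vec (Fin nv) (arity i))

  record Instance (nv : ℕ) : Set where
    field
      constraints : List (Constraint nv)

  IsSolution : ∀ {nv} → Instance nv → (Fin nv → Fin size) → Set
  IsSolution I f = All (λ c → rel (proj₁ c) (map f (proj₂ c)) ≡ true) (Instance.constraints I)

  Satisfiable : ∀ {nv} → Instance nv → Set
  Satisfiable I = ∃ λ f → IsSolution I f

  Op3 : Set
  Op3 = Fin size → Fin size → Fin size → Fin size

  apply3 : ∀ {m} → Op3 → Vec (Fin size) m → Vec (Fin size) m → Vec (Fin size) m → Vec (Fin size) m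
  apply3 p a b c = zipWith (λ g z → g z) (zipWith p a b) c

  IsPolymorphism3 : Op3 → Set
  IsPolymorphism3 p = (i : Fin nRel) (a b c : Vec (Fin size) (arity i)) →
    rel i a ≡ true → rel i b ≡ true → rel i c ≡ true → rel i (apply3 p a b c) ≡ true

  IsHMChain : (n : ℕ) → (Fin (suc n) → Op3) → Set
  IsHMChain n p =
    ((x y z : Fin size) → p Fin.zero x y z ≡ x) ×
    ((i : Fin n) (x y : Fin size) → p (inject₁ i) x x y ≡ p (Fin.suc i) x y y) ×
    ((x y z : Fin size) → p (fromℕ n) x y z ≡ z)

  module Datalog (IDB : Set) (idbArity : IDB → ℕ) where

    Pred : Set
    Pred = Fin nRel ⊎ IDB

    predArity : Pred → ℕ
    predArity (inj₁ i) = arity i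
    predArity (inj₂ j) = idbArity j

    Atom : ℕ → Set
    Atom nv = Σ Pred (λ q → Vec (Fin nv) (predArity q))

    IsIDBAtom : ∀ {nv} → Atom nv → Set
    IsIDBAtom (inj₁ _ , _) = ⊥
    IsIDBAtom (inj₂ _ , _) = ⊤

    countIDB : ∀ {nv} → List (Atom nv) → ℕ
    countIDB [] = zero
    countIDB ((inj₁ _ , _) ∷ as) = countIDB as
    countIDB ((inj₂ _ , _) ∷ as) = suc (countIDB as)

    record Rule : Set where
      field
        nvars    : ℕ
        head     : IDB
        headArgs : Vec (Fin nvars) (idbArity head)
        body     : List (Atom nvars)

    headAtom : (ρ : Rule) → Atom (Rule.nvars ρ)
    headAtom ρ = inj₂ (Rule.head ρ) , Rule.headArgs ρ

    IsLinearRule : Rule → Set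
    IsLinearRule ρ = countIDB (Rule.body ρ) ≤ 1

    module Run (IsRule : Rule → Set) {nv : ℕ} (I : Instance nv) where

      data Derives : (q : Pred) → Vec (Fin nv) (predArity q) → Set where
        edb : ∀ {i σ} → (i , σ) ∈ Instance.constraints I → Derives (inj₁ i) σ
        app : (ρ : Rule) → IsRule ρ → (ω : Fin (Rule.nvars ρ) → Fin nv) →
              All (λ a → Derives (proj₁ a) (map ω (proj₂ a))) (Rule.body ρ) →
              Derives (inj₂ (Rule.head ρ)) (map ω (Rule.headArgs ρ))

    DerivesGoal : (IsRule : Rule → Set) (IsGoal : Pred → Set) → ∀ {nv} → Instance nv → Set
    DerivesGoal IsRule IsGoal I =
      Σ Pred λ q → Σ (Vec _ (predArity q)) λ args → IsGoal q × Run.Derives IsRule I q args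

    DecidesCSP : (IsRule : Rule → Set) (IsGoal : Pred → Set) → Set
    DecidesCSP IsRule IsGoal = (nv : ℕ) (I : Instance nv) →
      (DerivesGoal IsRule IsGoal I → ¬ Satisfiable I) × (¬ Satisfiable I → DerivesGoal IsRule IsGoal I)

  record Program : Set where
    field
      nIDB     : ℕ
      idbArity : Fin nIDB → ℕ
    open Datalog (Fin nIDB) idbArity public
    field
      rules : List Rule
      goal  : Pred → Bool

  ProgramDecides : Program → Set
  ProgramDecides P = DecidesCSP (λ ρ → ρ ∈ rules) (λ q → goal q ≡ true)
    where open Program P

  IsLinearProgram : Program → Set
  IsLinearProgram P = All IsLinearRule rules
    where open Program P

  module Symmetric (r : ℕ) where

    SIDB : Set
    SIDB = Σ (Fin (suc r)) (λ n → Vec (Fin size) (toℕ n) → Bool)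

    sArity : SIDB → ℕ
    sArity q = toℕ (proj₁ q)

    open Datalog SIDB sArity public

    Holds : ∀ {m} → (Fin m → Fin size) → Atom m → Set
    Holds f (inj₁ i , args)       = rel i (map f args) ≡ true
    Holds f (inj₂ (n , R) , args) = R (map f args) ≡ true

    ConsistentAt : ∀ {m} → Atom m → List (Atom m) → Set
    ConsistentAt {m} h bd = (f : Fin m → Fin size) → All (Holds f) bd → Holds f h

    -- non-IDB symbols of S^r exist only for basic relations of arity ≤ r
    SmallEDB : ∀ {m} → Atom m → Set
    SmallEDB (inj₁ i , _) = arity i ≤ r
    SmallEDB (inj₂ _ , _) = ⊤

    IsSRule : Rule → Set
    IsSRule ρ =
      (Rule.nvars ρ ≡ r) ×
      IsLinearRule ρ ×
      Unique (Rule.body ρ) ×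
      All SmallEDB (Rule.body ρ) ×
      ConsistentAt (headAtom ρ) (Rule.body ρ) ×
      ((a∈ : Σ (Atom (Rule.nvars ρ)) (λ a → a ∈ Rule.body ρ)) →
         IsIDBAtom (proj₁ a∈) →
         ConsistentAt (proj₁ a∈) (headAtom ρ ∷ (Rule.body ρ ─ proj₂ a∈)))

    IsSGoal : Pred → Set
    IsSGoal (inj₁ _)       = ⊥
    IsSGoal (inj₂ (n , R)) = (t : Vec (Fin size) (toℕ n)) → R t ≡ false

  SymmetricDecides : ℕ → Set
  SymmetricDecides r = DecidesCSP IsSRule IsSGoal
    where open Symmetric r

{-# OPTIONS --safe #-}
module Submission where

open import Defs
open import Data.Nat using (ℕ; zero; suc; _+_; _*_; _^_; _≤_; _<_; z≤n; s≤s; _⊔_; _<?_;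
  _<′_; ≤′-refl; ≤′-step; NonZero)
open import Data.Nat.Properties
open import Data.Nat.Tactic.RingSolver using (solve-∀)
open import Data.Fin using (Fin; toℕ; fromℕ; fromℕ<; inject₁; inject≤; funToFin; finToFun; combine)
import Data.Fin as Fin
import Data.Fin.Properties as Fin
open import Data.Fin.Induction using (<-weakInduction)
open import Data.Bool using (Bool; true; false; _∧_)
import Data.Bool.Properties as Bool
open import Data.Empty using (⊥-elim)
open import Data.List using (List; []; _∷_; _++_; [_]; length; filter; initLast; _∷ʳ′_; allFin; applyUpTo;
  cartesianProduct; cartesianProductWith; concatMap)
import Data.List as List
import Data.List.Properties as List
open import Data.List.Relation.Unary.All as All using (All; []; _∷_; all?)
import Data.List.Relation.Unary.All.Properties as All
open import Data.List.Relation.Unary.Any using (here; there; any?)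
open import Data.List.Relation.Unary.AllPairs as AllPairs using (AllPairs; []; _∷_)
import Data.List.Relation.Unary.AllPairs.Properties as AllPairs
open import Data.List.Relation.Unary.Linked as Linked using (Linked; [-]; _∷_)
import Data.List.Relation.Unary.Linked.Properties as Linked
open import Data.List.Relation.Unary.Unique.Propositional using (Unique)
open import Data.List.Relation.Binary.Sublist.Propositional using (_⊆_; []; _∷_; _∷ʳ_; ⊆-refl)
open import Data.List.Relation.Binary.Sublist.Propositional.Properties using (All-resp-⊆; ++⁺ˡ; ++⁺ʳ)
open import Data.List.Membership.Propositional using (_∈_; lose)
open import Data.List.Membership.Propositional.Properties
open import Data.Product using (Σ; _,_; proj₁; proj₂; _×_; ∃)
open import Data.Product.Properties using (≡-dec)
open import Data.Sum using (_⊎_; inj₁; inj₂)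
open import Data.Unit using (⊤; tt)
open import Data.Vec as Vec using (Vec; []; _∷_; map; take; drop; toList; lookup; tabulate)
import Data.Vec.Properties as Vec
open import Function using (_∘_; id)
open import Relation.Binary.Definitions using (DecidableEquality; Transitive)
open import Relation.Binary.PropositionalEquality using (_≡_; refl; sym; trans; cong; cong₂; subst; module ≡-Reasoning)
open import Relation.Nullary using (¬_; Dec; does; yes; no; contradiction)
open import Relation.Nullary.Decidable using (_×-dec_; ¬?; decidable-stable; dec-true)

-- A linear derivation over an unsatisfiable instance is a path of bags of boundedly many variables,
-- consecutive bags being related by matrices whose product is zero: a path of values along the
-- derivation would itself be a derivation over 𝔸 viewed as an instance, which is satisfiable.
-- By Simon's factorization forest theorem this product is evaluated in bounded height, by binary
-- products and by powers e ⋯ e of idempotents. Symmetric Datalog performs both. For a power it moves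
-- from e(x₀,x_t) to e(x₀,x_u) and back, t and u consecutive: the Hagemann–Mitschke operations make e
-- symmetric on its loops, and since e = e ∘ e there are loops on both sides of every edge, so that
-- e(x₀,x_u) implies e(x₀,x_t) once the edges next to tu are known.

-- Factorization forests

-- The obstacle is that a symmetric rule may not forget: passing from F to a consequence G is not
-- reversible. It becomes reversible when F itself is derivable: F becomes F and G, and then the
-- derivation of F is run backwards with G carried along as a spectator, which leaves G alone.
-- Binary products are performed in this way. A spectator adds its width to every formula of the
-- derivation it accompanies, whereas derivations put one after the other keep the larger of their
-- widths. So arity is paid for nesting and not for length, and bounded height is what gives a
-- single r. The height depends only on N = `size ^ w`, where w comes from the program, so it is
-- fixed before the instance.

module _ {A : Set} where

  lastOf : A → List A → A
  lastOf x []       = x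
  lastOf _ (y ∷ ys) = lastOf y ys

  lastOf-++ : ∀ x ys z zs → lastOf x (ys ++ z ∷ zs) ≡ lastOf z zs
  lastOf-++ x []       z zs = refl
  lastOf-++ x (y ∷ ys) z zs = lastOf-++ y ys z zs

  AllPairs-resp-⊆ : ∀ {R : A → A → Set} {xs ys} → xs ⊆ ys → AllPairs R ys → AllPairs R xs
  AllPairs-resp-⊆ []         []         = []
  AllPairs-resp-⊆ (_ ∷ʳ sub) (_ ∷ rs)   = AllPairs-resp-⊆ sub rs
  AllPairs-resp-⊆ (refl ∷ sub) (r ∷ rs) = All-resp-⊆ sub r ∷ AllPairs-resp-⊆ sub rs

  AllPairs-refine : ∀ {R R′ : A → A → Set} {P Q : A → Set} →
    (∀ {x y} → P x → Q y → R x y → R′ x y) →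
    ∀ {x ys} → All P (x ∷ ys) → All Q ys → AllPairs R (x ∷ ys) → AllPairs R′ (x ∷ ys)
  AllPairs-refine f {ys = []} _ _ _ = [] ∷ []
  AllPairs-refine f {ys = _ ∷ _} (p ∷ ps) (q ∷ qs) (r ∷ rs) =
    All.zipWith (λ (q , r) → f p q r) (q ∷ qs , r) ∷ AllPairs-refine f ps qs rs

  Linked-split : ∀ {R : A → A → Set} x ys {z zs} → Linked R (x ∷ ys ++ z ∷ zs) →
    Linked R (x ∷ ys) × R (lastOf x ys) z × Linked R (z ∷ zs)
  Linked-split x []       (r ∷ rs) = [-] , r , rs
  Linked-split x (y ∷ ys) (r ∷ rs) = let as , b , cs = Linked-split y ys rs in r ∷ as , b , cs

  Linked⇒All : ∀ {P : A → Set} {x ys} → Linked (λ _ → P) (x ∷ ys) → All P ys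
  Linked⇒All [-]      = []
  Linked⇒All (p ∷ ps) = p ∷ Linked⇒All ps

  -- Greedy cutting: B is always tested from the latest cut, and the next cut is the first position
  -- that satisfies it.
  data Cuts (B : A → A → Set) (x : A) : List A → Set where
    done : ∀ {ys} → All (¬_ ∘ B x) ys → Cuts B x ys
    cut  : ∀ {ys z zs} → All (¬_ ∘ B x) ys → B x z → Cuts B z zs → Cuts B x (ys ++ z ∷ zs)

  cuts : ∀ {B : A → A → Set} → (∀ x y → Dec (B x y)) → ∀ x ys → Cuts B x ys
  cuts B? x [] = done []
  cuts B? x (y ∷ ys) with B? x y
  ... | yes b = cut [] b (cuts B? y ys)
  ... | no ¬b with cuts B? x ys
  ...   | done ¬bs       = done (¬b ∷ ¬bs)
  ...   | cut ¬bs b rest = cut (¬b ∷ ¬bs) b rest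

lastOf-≤ : ∀ {i is} → Linked _≤_ (i ∷ is) → i ≤ lastOf i is
lastOf-≤ [-]      = ≤-refl
lastOf-≤ (p ∷ ps) = ≤-trans p (lastOf-≤ ps)

module Factorization {S : Set} (_≟_ : DecidableEquality S) (_∙_ : S → S → S) where

  record System : Set₁ where
    field
      val     : ℕ → ℕ → S
      val-∙   : ∀ {i j k} → i ≤ j → j ≤ k → val i j ∙ val j k ≡ val i k
      Der     : ℕ → ℕ → ℕ → Set
      mono    : ∀ {h h′ i j} → h ≤ h′ → Der h i j → Der h′ i j
      empty   : ∀ {h i} → Der h i i
      concat  : ∀ {h i j k} → i ≤ j → j ≤ k → Der h i j → Der h j k → Der (suc h) i k
      iterate : ∀ {h e i is} → e ∙ e ≡ e →
                Linked (λ j k → j ≤ k × val j k ≡ e × Der h j k) (i ∷ is) → Der (suc h) i (lastOf i is)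

  Within : List S → System → ℕ → ℕ → Set
  Within T sys j k = j ≤ k × System.val sys j k ∈ T

  -- The bound is chosen before the system and the sequence. T need not be closed under `_∙_`: it
  -- only has to contain the values between the selected positions, a condition inherited by
  -- subsequences.
  Bounded : List S → Set₁
  Bounded T = ∀ h → Σ ℕ λ h′ → ∀ sys i is → let open System sys in
    AllPairs (Within T sys) (i ∷ is) → Linked (Der h) (i ∷ is) → Der h′ i (lastOf i is)

  module _ (sys : System) where
    open System sys

    -- Each stretch up to a cut becomes a single link, by `solve` on the positions before the cut
    -- and one `concat` with the last edge. The stretch after the final cut is returned separately.
    contract : ∀ {B R : ℕ → ℕ → Set} {h h₁} → (∀ {j k} → R j k → j ≤ k) →
      (∀ i us → AllPairs R (i ∷ us) → Linked (Der h) (i ∷ us) → All (¬_ ∘ B i) us →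
        Der h₁ i (lastOf i us)) →
      ∀ {i is} → Cuts B i is → AllPairs R (i ∷ is) → Linked (Der h) (i ∷ is) →
      Σ (List ℕ) λ js → (js ⊆ is) × Linked (λ j k → B j k × Der (suc (h ⊔ h₁)) j k) (i ∷ js) ×
        Der h₁ (lastOf i js) (lastOf i is) × lastOf i js ≤ lastOf i is
    contract R≤ solve (done ¬bs) rs ds =
      [] , ++⁺ʳ _ [] , [-] , solve _ _ rs ds ¬bs , lastOf-≤ (Linked.map R≤ (Linked.AllPairs⇒Linked rs))
    contract {h = h} {h₁} R≤ solve {i} (cut {us} {j} {rest} ¬bs b c) rs ds =
      let rs₁          = AllPairs-resp-⊆ {xs = i ∷ us} (refl ∷ ++⁺ʳ (j ∷ rest) ⊆-refl) rs
          rs₂          = AllPairs-resp-⊆ {xs = j ∷ rest} (i ∷ʳ ++⁺ˡ us ⊆-refl) rs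
          ds₁ , d , ds₂ = Linked-split i us ds
          _ , m≤j , _  = Linked-split i us (Linked.map R≤ (Linked.AllPairs⇒Linked rs))
          js , js⊆ , l , t , le = contract R≤ solve c rs₂ ds₂
          step = concat (lastOf-≤ (Linked.map R≤ (Linked.AllPairs⇒Linked rs₁))) m≤j
                   (mono (m≤n⊔m h h₁) (solve i us rs₁ ds₁ ¬bs)) (mono (m≤m⊔n h h₁) d)
          eq   = sym (lastOf-++ i us j rest)
      in j ∷ js , ++⁺ˡ us (refl ∷ js⊆) , (b , step) ∷ l ,
         subst (Der h₁ _) eq t , subst (lastOf j js ≤_) eq le

  module Coloured {C : Set} (_≟ᶜ_ : DecidableEquality C) (T : C → List S) where

    -- Only the colour of the later end is constrained, because the first position of a segment need
    -- not have a colour from Q.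
    Within′ : List C → (ℕ → C) → System → ℕ → ℕ → Set
    Within′ Q col sys j k =
      j ≤ k × col k ∈ Q × (∀ {c} → col j ≡ c → col k ≡ c → System.val sys j k ∈ T c)

    -- Induction on the number of colours. Between cuts at the positions of colour c only the other
    -- colours occur; the cuts themselves have pairwise values in `T c`.
    coloured : ∀ Q → (∀ {c} → c ∈ Q → Bounded (T c)) → ∀ h → Σ ℕ λ h′ → ∀ sys col i is →
      let open System sys in
      AllPairs (Within′ Q col sys) (i ∷ is) → Linked (Der h) (i ∷ is) → Der h′ i (lastOf i is)
    coloured [] bd h = h , λ where
      sys col i []      _ _                        → System.empty sys
      sys col i (_ ∷ _) (((_ , () , _) ∷ _) ∷ _) _
    coloured (c ∷ Q) bd h with coloured Q (bd ∘ there) h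
    ... | h₁ , ih with bd (here refl) (suc (h ⊔ h₁))
    ... | h₃ , classBound = suc (suc h₄) , λ sys col i is rs ds →
      let open System sys
          js , js⊆ , l , t , le = contract sys {B = λ _ k → col k ≡ c} proj₁
            (λ i us rs ds ¬cs → ih sys col i us
              (AllPairs-refine (λ { _ k≢c (le , here eq , _) → contradiction eq k≢c
                                  ; _ _ (le , there k∈ , same) → le , k∈ , same })
                (All.universal (λ _ → tt) _) ¬cs rs) ds)
            (cuts (λ _ k → col k ≟ᶜ c) i is) rs ds
      in concat (lastOf-≤ (Linked.map proj₁ (Linked.AllPairs⇒Linked (AllPairs-resp-⊆ (refl ∷ js⊆) rs)))) le
           (class sys js (AllPairs-resp-⊆ (refl ∷ js⊆) rs) l)
           (mono (≤-trans (≤-trans (m≤n⊔m h h₁) (n≤1+n _)) (≤-trans (m≤m⊔n _ h₃) (n≤1+n _))) t)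
      where
      h₄ = suc (h ⊔ h₁) ⊔ h₃
      class : ∀ sys {col i} js → let open System sys in
        AllPairs (Within′ (c ∷ Q) col sys) (i ∷ js) →
        Linked (λ _ k → col k ≡ c × Der (suc (h ⊔ h₁)) _ k) (i ∷ js) → Der (suc h₄) i (lastOf i js)
      class sys [] _ _ = System.empty sys
      -- The colour of i is unknown, so the link from i to j stays outside the sequence given to
      -- `classBound`.
      class sys {col} (j ∷ js) (((i≤j , _) ∷ _) ∷ rs) ((c≡ , d) ∷ l) =
        let open System sys
            cs = Linked⇒All (Linked.map proj₁ l)
            within = AllPairs-refine (λ j≡c k≡c (le , _ , same) → le , same j≡c k≡c) (c≡ ∷ cs) cs rs
        in concat i≤j (lastOf-≤ (Linked.map proj₁ (Linked.AllPairs⇒Linked rs)))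
             (mono (m≤m⊔n _ h₃) d)
             (mono (m≤n⊔m _ h₃) (classBound sys j js within (Linked.map proj₂ l)))

  module _ (T : List S) where

    stab? : ∀ ((p , q) : S × S) u → Dec (p ∙ u ≡ p × u ∙ q ≡ q)
    stab? (p , q) u = ((p ∙ u) ≟ p) ×-dec ((u ∙ q) ≟ q)

    -- A position u will be coloured by the product p before it and the product q after it. If two
    -- positions share the colour (p , q), the value between them fixes p from the right and q from
    -- the left.
    Stab : S × S → List S
    Stab c = filter (stab? c) T

    Small : S × S → Set
    Small c = length (Stab c) < length T

    small? : ∀ c → Dec (Small c)
    small? c = length (Stab c) <? length T

    ¬small⇒stab : ∀ {c u} → ¬ Small c → u ∈ T → proj₁ c ∙ u ≡ proj₁ c × u ∙ proj₂ c ≡ proj₂ c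
    ¬small⇒stab {c} {u} ¬s u∈ = decidable-stable (stab? c u)
      λ ¬st → ¬s (List.filter-notAll (stab? c) T (lose u∈ ¬st))

    -- If (p , q) stabilises all of T ∋ p , q then p = p q = q is a zero of T.
    Zero : S → Set
    Zero z = z ∈ T × ¬ Small (z , z)

    zero? : ∀ z → Dec (Zero z)
    zero? z = any? (z ≟_) T ×-dec ¬? (small? (z , z))

    zero-unique : ∀ {y z} → Zero y → Zero z → y ≡ z
    zero-unique (y∈ , ¬y) (z∈ , ¬z) =
      trans (sym (proj₁ (¬small⇒stab ¬y z∈))) (proj₂ (¬small⇒stab ¬z y∈))

    nonzero⇒small : ∀ {p q} → p ∈ T → q ∈ T → ¬ Zero p → Small (p , q)
    nonzero⇒small {p} {q} p∈ q∈ ¬z = decidable-stable (small? (p , q)) λ ¬s →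
      let p≡q = trans (sym (proj₁ (¬small⇒stab ¬s q∈))) (proj₂ (¬small⇒stab ¬s p∈))
      in ¬z (p∈ , subst (λ q → ¬ Small (p , q)) (sym p≡q) ¬s)

    smallColours : List (S × S)
    smallColours = filter small? (cartesianProduct T T)

    open Coloured (≡-dec _≟_ _≟_) Stab

    -- Cutting as soon as the value since the last cut is a zero yields links that all equal one
    -- idempotent, a single use of `iterate`. Before a cut no prefix is a zero, so by
    -- `nonzero⇒small` every colour has a stabiliser shorter than T.
    bounded-step : (∀ {c} → Small c → Bounded (Stab c)) → Bounded T
    bounded-step bd h with coloured smallColours (bd ∘ proj₂ ∘ ∈-filter⁻ small? {xs = cartesianProduct T T}) h
    ... | h₁ , solveColoured = suc (suc h₃) , λ sys i is rs ds →
      let open System sys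
          js , js⊆ , l , t , le = contract sys {B = λ j k → Zero (val j k)} proj₁ (segment sys)
            (cuts (λ j k → zero? (val j k)) i is) rs ds
          rs′ = AllPairs-resp-⊆ (refl ∷ js⊆) rs
      in concat (lastOf-≤ (Linked.map proj₁ (Linked.AllPairs⇒Linked rs′))) le
           (zeros sys (Linked.zip (Linked.map proj₁ (Linked.AllPairs⇒Linked rs′) , l)))
           (mono (≤-trans (m≤n⊔m h h₂) (≤-trans (n≤1+n _) (n≤1+n _))) t)
      where
      h₂ = suc (h ⊔ h₁)
      h₃ = suc (h ⊔ h₂)

      segment : ∀ sys → let open System sys in ∀ i us → AllPairs (Within T sys) (i ∷ us) →
        Linked (Der h) (i ∷ us) → All (λ u → ¬ Zero (val i u)) us → Der h₂ i (lastOf i us)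
      -- The last position l is set apart as the right end for the colours: `val l l` is not known
      -- to lie in T.
      segment sys i us rs ds ¬zs with initLast us
      ... | []         = System.empty sys
      ... | us′ ∷ʳ′ l = subst (Der h₂ i) (sym (lastOf-++ i us′ l []))
        (concat (lastOf-≤ (Linked.map proj₁ (Linked.AllPairs⇒Linked inner)))
          (proj₁ (proj₂ (Linked-split i us′ (Linked.map proj₁ (Linked.AllPairs⇒Linked rs)))))
          (mono (m≤n⊔m h h₁) (solveColoured sys col i us′
            (AllPairs-refine refine
              (All-resp-⊆ (refl ∷ ++⁺ʳ [ l ] ⊆-refl) (≤-refl ∷ All.map proj₁ (AllPairs.head rs)))
              (All.zip ( All-resp-⊆ (++⁺ʳ [ l ] ⊆-refl) (All.zip (AllPairs.head rs , ¬zs))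
                       , toLast us′ (AllPairs.tail rs)))
              inner)
            (proj₁ (Linked-split i us′ ds))))
          (mono (m≤m⊔n h h₁) (proj₁ (proj₂ (Linked-split i us′ ds)))))
        where
        open System sys
        col : ℕ → S × S
        col u = val i u , val u l
        inner = AllPairs-resp-⊆ {xs = i ∷ us′} (refl ∷ ++⁺ʳ [ l ] ⊆-refl) rs
        toLast : ∀ us → AllPairs (Within T sys) (us ++ [ l ]) → All (λ u → Within T sys u l) us
        toLast []       _        = []
        toLast (u ∷ us) (r ∷ rs) = All.lookup r (Any-last us) ∷ toLast us rs
          where
          Any-last : ∀ us → l ∈ us ++ [ l ]
          Any-last []       = here refl
          Any-last (_ ∷ us) = there (Any-last us)
        refine : ∀ {j k} → i ≤ j → ((Within T sys i k) × ¬ Zero (val i k)) × Within T sys k l →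
          Within T sys j k → Within′ smallColours col sys j k
        refine {j} {k} i≤j (((i≤k , p∈) , ¬z) , (k≤l , q∈)) (j≤k , u∈) =
          j≤k , ∈-filter⁺ small? (∈-cartesianProduct⁺ p∈ q∈) (nonzero⇒small p∈ q∈ ¬z) ,
          λ {c} → λ where
            eqj refl → ∈-filter⁺ (stab? c) u∈
              ( trans (cong (_∙ val j k) (sym (cong proj₁ eqj))) (val-∙ i≤j j≤k)
              , trans (val-∙ j≤k k≤l) (cong proj₂ eqj))

      zeros : ∀ sys {i js} → let open System sys in
        Linked (λ j k → j ≤ k × Zero (val j k) × Der h₃ j k) (i ∷ js) →
        Der (suc h₃) i (lastOf i js)
      zeros sys [-] = System.empty sys
      zeros sys (r@(_ , z , _) ∷ rs) =
        -- A zero absorbs every element of T, itself included, hence is idempotent.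
        System.iterate sys (proj₁ (¬small⇒stab (proj₂ z) (proj₁ z)))
          (Linked.map (λ (le , z′ , d) → le , zero-unique z′ z , d) (r ∷ rs))

  bounded : ∀ n T → length T < n → Bounded T
  bounded (suc n) T (s≤s T≤n) =
    bounded-step T λ {c} small → bounded n (Stab T c) (<-≤-trans small T≤n)

-- Enumeration of vectors and reflection of Booleans

module _ {A : Set} where

  vectors : List A → ∀ n → List (Vec A n)
  vectors xs zero    = [] ∷ []
  vectors xs (suc n) = cartesianProductWith _∷_ xs (vectors xs n)

  ∈-vectors : ∀ {xs} → (∀ x → x ∈ xs) → ∀ {n} (v : Vec A n) → v ∈ vectors xs n
  ∈-vectors all []      = here refl
  ∈-vectors all (x ∷ v) = ∈-cartesianProductWith⁺ _∷_ (all x) (∈-vectors all v)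

does⁻ : ∀ {P : Set} (P? : Dec P) → does P? ≡ true → P
does⁻ (yes p) _ = p

≡true-ext : ∀ {x y : Bool} → (x ≡ true → y ≡ true) → (y ≡ true → x ≡ true) → x ≡ y
≡true-ext {false} {false} _ _ = refl
≡true-ext {false} {true}  _ g = g refl
≡true-ext {true}  {y}     f _ = sym (f refl)

-- Boolean matrices and Hagemann–Mitschke operations

BoolMatrix : ℕ → Set
BoolMatrix N = Vec (Vec Bool N) N

module _ {N : ℕ} where

  infixl 7 _⊙_

  matrix : (Fin N → Fin N → Bool) → BoolMatrix N
  matrix f = tabulate (tabulate ∘ f)

  entry : BoolMatrix N → Fin N → Fin N → Bool
  entry M a = lookup (lookup M a)

  entry-matrix : ∀ f a b → entry (matrix f) a b ≡ f a b
  entry-matrix f a b =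
    trans (cong (λ r → lookup r b) (Vec.lookup∘tabulate (tabulate ∘ f) a)) (Vec.lookup∘tabulate (f a) b)

  Entry : BoolMatrix N → Fin N → Fin N → Set
  Entry M a b = entry M a b ≡ true

  fromDec : {R : Fin N → Fin N → Set} → (∀ a b → Dec (R a b)) → BoolMatrix N
  fromDec R? = matrix λ a b → does (R? a b)

  module _ {R : Fin N → Fin N → Set} (R? : ∀ a b → Dec (R a b)) where

    fromDec⁺ : ∀ {a b} → R a b → Entry (fromDec R?) a b
    fromDec⁺ r = trans (entry-matrix _ _ _) (dec-true (R? _ _) r)

    fromDec⁻ : ∀ {a b} → Entry (fromDec R?) a b → R a b
    fromDec⁻ e = does⁻ (R? _ _) (trans (sym (entry-matrix _ _ _)) e)

  matrix-ext : ∀ {M M′} → (∀ {a b} → Entry M a b → Entry M′ a b) →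
    (∀ {a b} → Entry M′ a b → Entry M a b) → M ≡ M′
  matrix-ext {M} {M′} f g = trans (sym (matrix-entry M)) (trans
    (Vec.tabulate-cong λ a → Vec.tabulate-cong λ b → ≡true-ext (f {a} {b}) (g {a} {b}))
    (matrix-entry M′))
    where
    matrix-entry : ∀ M → matrix (entry M) ≡ M
    matrix-entry M = trans (Vec.tabulate-cong λ a → Vec.tabulate∘lookup (lookup M a)) (Vec.tabulate∘lookup M)

  compose? : ∀ M M′ a c → Dec (∃ λ b → Entry M a b × Entry M′ b c)
  compose? M M′ a c = Fin.any? λ b → (entry M a b Bool.≟ true) ×-dec (entry M′ b c Bool.≟ true)

  abstract

    _⊙_ : BoolMatrix N → BoolMatrix N → BoolMatrix N
    M ⊙ M′ = fromDec (compose? M M′)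

    ⊙⁺ : ∀ M M′ {a b c} → Entry M a b → Entry M′ b c → Entry (M ⊙ M′) a c
    ⊙⁺ M M′ p q = fromDec⁺ (compose? M M′) (_ , p , q)

    ⊙⁻ : ∀ M M′ {a c} → Entry (M ⊙ M′) a c → ∃ λ b → Entry M a b × Entry M′ b c
    ⊙⁻ M M′ = fromDec⁻ (compose? M M′)

    𝟙 : BoolMatrix N
    𝟙 = fromDec Fin._≟_

    𝟙⁺ : ∀ {a} → Entry 𝟙 a a
    𝟙⁺ = fromDec⁺ Fin._≟_ refl

    𝟙⁻ : ∀ {a b} → Entry 𝟙 a b → a ≡ b
    𝟙⁻ = fromDec⁻ Fin._≟_

  ⊙-assoc : ∀ M M′ M″ → (M ⊙ M′) ⊙ M″ ≡ M ⊙ (M′ ⊙ M″)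
  ⊙-assoc M M′ M″ = matrix-ext
    (λ p → let _ , q , r = ⊙⁻ (M ⊙ M′) M″ p ; _ , s , t = ⊙⁻ M M′ q in ⊙⁺ M (M′ ⊙ M″) s (⊙⁺ M′ M″ t r))
    (λ p → let _ , q , r = ⊙⁻ M (M′ ⊙ M″) p ; _ , s , t = ⊙⁻ M′ M″ r in ⊙⁺ (M ⊙ M′) M″ (⊙⁺ M M′ q s) t)

  ⊙-identityˡ : ∀ M → 𝟙 ⊙ M ≡ M
  ⊙-identityˡ M = matrix-ext
    (λ {_} {c} p → let _ , q , r = ⊙⁻ 𝟙 M p in subst (λ a → Entry M a c) (sym (𝟙⁻ q)) r)
    (λ {a} → ⊙⁺ 𝟙 M {a} 𝟙⁺)

  _≟ᴹ_ : DecidableEquality (BoolMatrix N)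
  _≟ᴹ_ = Vec.≡-dec (Vec.≡-dec Bool._≟_)

matrices : ∀ N → List (BoolMatrix N)
matrices N = vectors (vectors (true ∷ false ∷ []) N) N

∈-matrices : ∀ {N} (M : BoolMatrix N) → M ∈ matrices N
∈-matrices = ∈-vectors (∈-vectors λ { true → here refl ; false → there (here refl) })

module _ {N : ℕ} where

  val : (ℕ → BoolMatrix N) → ℕ → ℕ → BoolMatrix N
  val L zero    zero    = 𝟙
  val L zero    (suc j) = L 0 ⊙ val (L ∘ suc) zero j
  -- A dummy value for reversed intervals.
  val L (suc i) zero    = 𝟙
  val L (suc i) (suc j) = val (L ∘ suc) i j

  val-⊙ : ∀ L {i j k} → i ≤ j → j ≤ k → val L i j ⊙ val L j k ≡ val L i k
  val-⊙ L {zero} {zero}  {k} _ _ = ⊙-identityˡ (val L zero k)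
  val-⊙ L {zero} {suc j} {suc k} _ (s≤s j≤k) =
    trans (⊙-assoc (L 0) (val (L ∘ suc) zero j) (val (L ∘ suc) j k)) (cong (L 0 ⊙_) (val-⊙ (L ∘ suc) {zero} {j} z≤n j≤k))
  val-⊙ L {suc i} {suc j} {suc k} (s≤s i≤j) (s≤s j≤k) = val-⊙ (L ∘ suc) {i} {j} {k} i≤j j≤k

  val-preserves : ∀ {P : BoolMatrix N → Set} → P 𝟙 → (∀ {M M′} → P M → P M′ → P (M ⊙ M′)) →
    ∀ {L} → (∀ t → P (L t)) → ∀ i j → P (val L i j)
  val-preserves p𝟙 p⊙ pL zero    zero    = p𝟙
  val-preserves {P} p𝟙 p⊙ {L} pL zero    (suc j) = p⊙ {L 0} (pL 0) (val-preserves {P} p𝟙 p⊙ {L ∘ suc} (pL ∘ suc) zero j)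
  val-preserves p𝟙 p⊙ pL (suc i) zero    = p𝟙
  val-preserves {P} p𝟙 p⊙ {L} pL (suc i) (suc j) = val-preserves {P} p𝟙 p⊙ {L ∘ suc} (pL ∘ suc) i j

  val-step : ∀ L t → val L t (suc t) ≡ L t
  val-step L zero    = matrix-ext
    (λ {a} p → let _ , q , r = ⊙⁻ (L 0) 𝟙 p in subst (Entry (L 0) a) (𝟙⁻ r) q)
    (λ {a} {b} p → ⊙⁺ (L 0) 𝟙 {a} {b} {b} p 𝟙⁺)
  val-step L (suc t) = val-step (L ∘ suc) t

Preserves : {X : Set} → (X → X → X → X) → (X → X → Set) → Set
Preserves p E = ∀ {a b c a′ b′ c′} → E a a′ → E b b′ → E c c′ → E (p a b c) (p a′ b′ c′)

module HagemannMitschke {X : Set} {n : ℕ} (p : Fin (suc n) → X → X → X → X)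
  (p-first : ∀ x y z → p Fin.zero x y z ≡ x)
  (p-link  : ∀ (i : Fin n) x y → p (inject₁ i) x x y ≡ p (Fin.suc i) x y y)
  (p-last  : ∀ x y z → p (fromℕ n) x y z ≡ z) where

  -- y = p₀(y,x,x) → p₀(y,y,x) = p₁(y,x,x) → ⋯ → pₙ(y,y,x) = x, each arrow being an edge of E.
  symmetric-on-loops : ∀ {E : X → X → Set} → (∀ i → Preserves (p i) E) → Transitive E →
    ∀ {x y} → E x x → E y y → E x y → E y x
  symmetric-on-loops {E} pres E-trans {x} {y} xx yy xy =
    subst (E y) (p-last y y x) (<-weakInduction (λ i → E y (p i y y x))
      (subst (λ z → E z (p Fin.zero y y x)) (p-first y x x) (edge Fin.zero))
      (λ i e → E-trans e (subst (λ z → E z (p (Fin.suc i) y y x)) (sym (p-link i y x)) (edge (Fin.suc i))))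
      (fromℕ n))
    where
    edge : ∀ i → E (p i y x x) (p i y y x)
    edge i = pres i yy xy xx

module _ {N : ℕ} {E : Fin N → Fin N → Set} (E-trans : Transitive E)
  (E-dense : ∀ {x y} → E x y → ∃ λ z → E x z × E z y) where

  -- Interpolating again and again between x and the latest point gives an infinite descending chain
  -- below y. Two of its points coincide, and transitivity makes that point a loop.
  loop-between : ∀ {x y} → E x y → ∃ λ z → E x z × E z z × E z y
  loop-between {x} {y} xy =
    -- The shift by `suc` excludes `point 0`, which is y itself and has no known edge to y.
    let i , j , i<j , eq = Fin.pigeonhole (n<1+n N) (λ i → point (suc (toℕ i)))
    in point (suc (toℕ i)) , proj₂ (seq (suc (toℕ i))) ,
       subst (λ z → E z (point (suc (toℕ i)))) (sym eq)
         (descend {suc (toℕ i)} {suc (toℕ j)} (<⇒<′ (s≤s i<j))) ,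
       descend {0} {suc (toℕ i)} (<⇒<′ (s≤s z≤n))
    where
    seq : ℕ → ∃ (E x)
    seq zero    = y , xy
    seq (suc k) = let z , xz , _ = E-dense (proj₂ (seq k)) in z , xz
    point : ℕ → Fin N
    point k = proj₁ (seq k)
    edge : ∀ k → E (point (suc k)) (point k)
    edge k = proj₂ (proj₂ (E-dense (proj₂ (seq k))))
    descend : ∀ {i j} → i <′ j → E (point j) (point i)
    descend {i} ≤′-refl       = edge i
    descend (≤′-step {j} i<j) = E-trans (edge j) (descend i<j)

  -- Loops y → t → u → z give z → y by symmetry, hence x → u → z → y → t.
  retract : (∀ {x y} → E x x → E y y → E x y → E y x) →
    ∀ {x s t u v} → E s t → E t u → E u v → E x u → E x t
  retract sym-loops st tu uv xu =
    let y , _ , yy , yt = loop-between st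
        z , uz , zz , _ = loop-between uv
        zy = sym-loops yy zz (E-trans yt (E-trans tu uz))
    in E-trans (E-trans (E-trans xu uz) zy) yt

-- Symmetric Datalog derivations

take-++ : ∀ {A : Set} {m n} (xs : Vec A m) (ys : Vec A n) → take m (xs Vec.++ ys) ≡ xs
take-++ {m = m} xs ys = Vec.++-injectiveˡ _ xs (Vec.take++drop≡id m (xs Vec.++ ys))

drop-++ : ∀ {A : Set} {m n} (xs : Vec A m) (ys : Vec A n) → drop m (xs Vec.++ ys) ≡ ys
drop-++ {m = m} xs ys = Vec.++-injectiveʳ (take m (xs Vec.++ ys)) xs (Vec.take++drop≡id m (xs Vec.++ ys))

-- Rules speak about r program variables, so the instance variables in a rule application need
-- names. The strict bound leaves a default name for variables outside L.
naming : ∀ {nv} (L : List (Fin (suc nv))) {r} → length L < r →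
  Σ (Fin (suc nv) → Fin r) λ name → Σ (Fin r → Fin (suc nv)) λ ω → ∀ {v} → v ∈ L → ω (name v) ≡ v
naming [] {suc r} _ = (λ _ → Fin.zero) , (λ _ → Fin.zero) , λ ()
naming {nv} (x ∷ L) {suc r} (s≤s L<r) with naming L L<r
... | name , ω , inv = name′ , ω′ , inv′
  where
  choose : ∀ v → Dec (v ≡ x) → Fin (suc r)
  choose v (yes _) = Fin.zero
  choose v (no _)  = Fin.suc (name v)
  name′ : Fin (suc nv) → Fin (suc r)
  name′ v = choose v (v Fin.≟ x)
  ω′ : Fin (suc r) → Fin (suc nv)
  ω′ Fin.zero    = x
  ω′ (Fin.suc i) = ω i
  inv′ : ∀ {v} → v ∈ x ∷ L → ω′ (name′ v) ≡ v
  inv′ {v} v∈ with v Fin.≟ x | v∈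
  ... | yes eq | _        = sym eq
  ... | no ≢x  | here eq  = contradiction eq ≢x
  ... | no _   | there ∈L = inv ∈L

map-fixed : ∀ {A : Set} {n} (g : A → A) (xs : Vec A n) → (∀ {x} → x ∈ toList xs → g x ≡ x) → map g xs ≡ xs
map-fixed g []       fix = refl
map-fixed g (x ∷ xs) fix = cong₂ _∷_ (fix (here refl)) (map-fixed g xs (fix ∘ there))

∧-true : ∀ {x y} → x ∧ y ≡ true → x ≡ true × y ≡ true
∧-true {true} {true} _ = refl , refl

∧-absorb : ∀ x {y} → (x ≡ true → y ≡ true) → x ≡ x ∧ y
∧-absorb false f = refl
∧-absorb true  f = sym (f refl)

∧-cong-true : ∀ x {y z} → (x ≡ true → y ≡ z) → x ∧ y ≡ x ∧ z
∧-cong-true false f = refl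
∧-cong-true true  f = f refl

-- Reversible derivations between formulas of bounded width

module Formulas (𝔸 : Structure) {nv : ℕ} (I : Instance 𝔸 nv) where

  open Structure 𝔸
  open Instance I

  record Formula : Set where
    constructor formula
    field
      {width} : ℕ
      args    : Vec (Fin nv) width
      table   : Vec (Fin size) width → Bool

  open Formula using (width) public

  ⟦_⟧ : Formula → (Fin nv → Fin size) → Bool
  ⟦ formula ρ R ⟧ f = R (map f ρ)

  _⊨_ : (Fin nv → Fin size) → Formula → Set
  f ⊨ F = ⟦ F ⟧ f ≡ true

  𝕋 : Formula
  𝕋 = formula [] λ _ → true

  infixr 6 _⩓_

  _⩓_ : Formula → Formula → Formula
  formula {m} ρ R ⩓ formula σ S = formula (ρ Vec.++ σ) λ t → R (take m t) ∧ S (drop m t)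

  ⟦⩓⟧ : ∀ F G f → ⟦ F ⩓ G ⟧ f ≡ ⟦ F ⟧ f ∧ ⟦ G ⟧ f
  ⟦⩓⟧ (formula ρ R) (formula σ S) f rewrite Vec.map-++ f ρ σ =
    cong₂ (λ s t → R s ∧ S t) (take-++ (map f ρ) (map f σ)) (drop-++ (map f ρ) (map f σ))

  ⊨-⩓⁻ : ∀ F G {f} → f ⊨ (F ⩓ G) → (f ⊨ F) × (f ⊨ G)
  ⊨-⩓⁻ F G {f} p = ∧-true (trans (sym (⟦⩓⟧ F G f)) p)

  atom : Constraint 𝔸 nv → Formula
  atom (i , σ) = formula σ (rel i)

  infix 4 _⊢_≈_

  -- Every step can be run in both directions by rules of the symmetric program.
  data _⊢_≈_ (q : ℕ) : Formula → Formula → Set where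
    local  : ∀ {F G} → width F ≤ q → width G ≤ q → (∀ f → ⟦ F ⟧ f ≡ ⟦ G ⟧ f) → q ⊢ F ≈ G
    adjoin : ∀ {F c} → c ∈ constraints → width F + width (atom c) ≤ q → q ⊢ F ≈ F ⩓ atom c
    flip   : ∀ {F G} → q ⊢ F ≈ G → q ⊢ G ≈ F
    _⨾_    : ∀ {F G H} → q ⊢ F ≈ G → q ⊢ G ≈ H → q ⊢ F ≈ H

  infixr 5 _⨾_

  width-≤ : ∀ {q F G} → q ⊢ F ≈ G → width F ≤ q × width G ≤ q
  width-≤ (local p q _)    = p , q
  width-≤ (adjoin {F} _ p) = m+n≤o⇒m≤o (width F) p , p
  width-≤ (flip d)         = let p , q = width-≤ d in q , p
  width-≤ (d ⨾ e)          = proj₁ (width-≤ d) , proj₂ (width-≤ e)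

  weaken : ∀ {q q′ F G} → q ≤ q′ → q ⊢ F ≈ G → q′ ⊢ F ≈ G
  weaken le (local p q e) = local (≤-trans p le) (≤-trans q le) e
  weaken le (adjoin c p)  = adjoin c (≤-trans p le)
  weaken le (flip d)      = flip (weaken le d)
  weaken le (d ⨾ e)       = weaken le d ⨾ weaken le e

  -- X is a spectator, paid for once however long the derivation is. Only `adjoin` needs care: the
  -- new constraint arrives behind X and has to be moved past it.
  frame : ∀ {q F G} X → q ⊢ F ≈ G → (q + width X) ⊢ F ⩓ X ≈ G ⩓ X
  frame X (local {F} {G} p q e) = local (+-monoˡ-≤ (width X) p) (+-monoˡ-≤ (width X) q)
    λ f → trans (⟦⩓⟧ F X f) (trans (cong (_∧ ⟦ X ⟧ f) (e f)) (sym (⟦⩓⟧ G X f)))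
  frame {q} X (adjoin {F} {c} c∈ p) = adjoin c∈ le ⨾ local le (+-monoˡ-≤ (width X) p) λ f → begin
    ⟦ (F ⩓ X) ⩓ C ⟧ f               ≡⟨ ⟦⩓⟧ (F ⩓ X) C f ⟩
    ⟦ F ⩓ X ⟧ f ∧ ⟦ C ⟧ f           ≡⟨ cong (_∧ ⟦ C ⟧ f) (⟦⩓⟧ F X f) ⟩
    (⟦ F ⟧ f ∧ ⟦ X ⟧ f) ∧ ⟦ C ⟧ f   ≡⟨ Bool.∧-assoc (⟦ F ⟧ f) _ _ ⟩
    ⟦ F ⟧ f ∧ (⟦ X ⟧ f ∧ ⟦ C ⟧ f)   ≡⟨ cong (⟦ F ⟧ f ∧_) (Bool.∧-comm (⟦ X ⟧ f) _) ⟩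
    ⟦ F ⟧ f ∧ (⟦ C ⟧ f ∧ ⟦ X ⟧ f)   ≡⟨ Bool.∧-assoc (⟦ F ⟧ f) _ _ ⟨
    (⟦ F ⟧ f ∧ ⟦ C ⟧ f) ∧ ⟦ X ⟧ f   ≡⟨ cong (_∧ ⟦ X ⟧ f) (⟦⩓⟧ F C f) ⟨
    ⟦ F ⩓ C ⟧ f ∧ ⟦ X ⟧ f           ≡⟨ ⟦⩓⟧ (F ⩓ C) X f ⟨
    ⟦ (F ⩓ C) ⩓ X ⟧ f               ∎
    where
    open ≡-Reasoning
    C = atom c
    le : width F + width X + width C ≤ q + width X
    le = ≤-trans (≤-reflexive (trans (+-assoc (width F) _ _) (trans (cong (width F +_) (+-comm (width X) _))
           (sym (+-assoc (width F) _ _))))) (+-monoˡ-≤ (width X) p)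
  frame X (flip d) = flip (frame X d)
  frame X (d ⨾ e)  = frame X d ⨾ frame X e

  infix 4 _⊢_

  _⊢_ : ℕ → Formula → Set
  q ⊢ F = q ⊢ 𝕋 ≈ F

  conjoin : ∀ {q F G} → q ⊢ F → q ⊢ G → (q + width G) ⊢ F ⩓ G
  conjoin {q} {F} {G} d e = weaken (m≤m+n q _) e ⨾
    local (m≤n+m (width G) q) (m≤n+m (width G) q) (λ f → sym (⟦⩓⟧ 𝕋 G f)) ⨾ frame G d

  -- F is equivalent to `F ⩓ G`; then the derivation of F is reversed with G as spectator, so that F
  -- disappears and G remains.
  deduce : ∀ {q F} G → q ⊢ F → (∀ f → f ⊨ F → f ⊨ G) → (q + width G) ⊢ G
  deduce {q} {F} G d imp = weaken (m≤m+n q _) d ⨾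
    local (≤-trans F≤q (m≤m+n q _)) (+-monoˡ-≤ (width G) F≤q)
      (λ f → trans (∧-absorb (⟦ F ⟧ f) (imp f)) (sym (⟦⩓⟧ F G f))) ⨾
    flip (frame G d) ⨾ local (m≤n+m (width G) q) (m≤n+m (width G) q) (⟦⩓⟧ 𝕋 G)
    where F≤q = proj₂ (width-≤ d)

  -- H is derived next to F, F is exchanged for G under H, and H is withdrawn by its own derivation
  -- run backwards.
  replace : ∀ {q H F G w} → q ⊢ H → width F ≡ w → width G ≡ w →
    (∀ f → f ⊨ H → ⟦ F ⟧ f ≡ ⟦ G ⟧ f) → (q + w) ⊢ F ≈ G
  replace {q} {H} {F} {G} d refl eq imp =
    local (m≤n+m _ q) (m≤n+m _ q) (λ f → sym (⟦⩓⟧ 𝕋 F f)) ⨾ frame F d ⨾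
    local (+-monoˡ-≤ _ H≤q) (+-mono-≤ H≤q (≤-reflexive eq))
      (λ f → trans (⟦⩓⟧ H F f) (trans (∧-cong-true (⟦ H ⟧ f) (imp f)) (sym (⟦⩓⟧ H G f)))) ⨾
    subst (λ w → (q + w) ⊢ H ⩓ G ≈ 𝕋 ⩓ G) eq (flip (frame G d)) ⨾
    local (≤-trans (≤-reflexive eq) (m≤n+m _ q)) (≤-trans (≤-reflexive eq) (m≤n+m _ q)) (⟦⩓⟧ 𝕋 G)
    where H≤q = proj₂ (width-≤ d)

-- Soundness of the symmetric program

module SymmetricRun (𝔸 : Structure) {nv : ℕ} (I : Instance 𝔸 nv) (r : ℕ) where

  open Structure 𝔸
  open Instance I
  open Symmetric 𝔸 r
  open Run IsSRule I

  Holds-∘ : ∀ {m k} (f : Fin k → Fin size) (ω : Fin m → Fin k) q args →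
    Holds f (q , map ω args) → Holds (f ∘ ω) (q , args)
  Holds-∘ f ω (inj₁ i)       args = subst (λ t → rel i t ≡ true) (sym (Vec.map-∘ f ω args))
  Holds-∘ f ω (inj₂ (n , R)) args = subst (λ t → R t ≡ true) (sym (Vec.map-∘ f ω args))

  Holds-∘⁻ : ∀ {m k} (f : Fin k → Fin size) (ω : Fin m → Fin k) q args →
    Holds (f ∘ ω) (q , args) → Holds f (q , map ω args)
  Holds-∘⁻ f ω (inj₁ i)       args = subst (λ t → rel i t ≡ true) (Vec.map-∘ f ω args)
  Holds-∘⁻ f ω (inj₂ (n , R)) args = subst (λ t → R t ≡ true) (Vec.map-∘ f ω args)

  module _ {f : Fin nv → Fin size} (sol : IsSolution 𝔸 I f) where

    sound  : ∀ {q args} → Derives q args → Holds f (q , args)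
    sounds : ∀ {m} {ω : Fin m → Fin nv} {as : List (Atom m)} →
      All (λ a → Derives (proj₁ a) (map ω (proj₂ a))) as → All (Holds (f ∘ ω)) as

    sound (edb c∈) = All.lookup sol c∈
    sound (app ρ (_ , _ , _ , _ , consistent , _) ω ds) =
      Holds-∘⁻ f ω (inj₂ (Rule.head ρ)) (Rule.headArgs ρ) (consistent (f ∘ ω) (sounds ds))

    sounds []                          = []
    sounds {ω = ω} {as = (q , args) ∷ _} (d ∷ ds) = Holds-∘ f ω q args (sound d) ∷ sounds ds

  goal-sound : DerivesGoal IsSRule IsSGoal I → ¬ Satisfiable 𝔸 I
  goal-sound (inj₂ (n , R) , args , goal , d) (f , sol) = contradiction (trans (sym (goal (map f args))) (sound sol d)) λ ()

-- Reversible derivations as runs of the symmetric program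

module SymmetricDerivations (𝔸 : Structure) {nv : ℕ} (I : Instance 𝔸 (suc nv)) (q : ℕ) where

  open Structure 𝔸
  open Instance I
  open Formulas 𝔸 I

  -- A rule mentions at most q variables in its head, q in its IDB atom and q in one constraint; one
  -- further name is the default of `naming`.
  r : ℕ
  r = suc (q + (q + q))

  open Symmetric 𝔸 r
  open Run IsSRule I

  q≤r : q ≤ r
  q≤r = ≤-trans (m≤m+n q (q + q)) (n≤1+n _)

  edbAtom : ∀ {m} → Σ (Fin nRel) (λ i → Vec (Fin m) (arity i)) → Atom m
  edbAtom (i , σ) = inj₁ i , σ

  module _ {n n′ : Fin (suc r)}
    (ρ : Vec (Fin (suc nv)) (toℕ n)) (R : Vec (Fin size) (toℕ n) → Bool)
    (ρ′ : Vec (Fin (suc nv)) (toℕ n′)) (R′ : Vec (Fin size) (toℕ n′) → Bool)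
    (E : List (Constraint 𝔸 (suc nv))) (E⊆ : All (_∈ constraints) E) (short : length E ≤ 1)
    (n≤q : toℕ n ≤ q) (n′≤q : toℕ n′ ≤ q) (E≤q : All (λ c → arity (proj₁ c) ≤ q) E)
    (equiv : ∀ f → All (λ c → rel (proj₁ c) (map f (proj₂ c)) ≡ true) E → R (map f ρ) ≡ R′ (map f ρ′)) where

    private

      flat : List (Constraint 𝔸 (suc nv)) → List (Fin (suc nv))
      flat []      = []
      flat (c ∷ E) = toList (proj₂ c) ++ flat E

      ∈-flat : ∀ {c v E} → c ∈ E → v ∈ toList (proj₂ c) → v ∈ flat E
      ∈-flat (here refl) v∈ = ∈-++⁺ˡ v∈
      ∈-flat {E = c ∷ _} (there c∈) v∈ = ∈-++⁺ʳ (toList (proj₂ c)) (∈-flat c∈ v∈)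

      flat-length : ∀ {E} → length E ≤ 1 → All (λ c → arity (proj₁ c) ≤ q) E → length (flat E) ≤ q
      flat-length {[]}         _ _        = z≤n
      flat-length {(i , σ) ∷ []} _ (le ∷ _) =
        ≤-trans (≤-reflexive (trans (cong length (List.++-identityʳ (toList σ))) (Vec.length-toList σ))) le
      flat-length {_ ∷ _ ∷ _} (s≤s ()) _

      vars : List (Fin (suc nv))
      vars = toList ρ ++ toList ρ′ ++ flat E

      vars-length : length vars < r
      vars-length = s≤s (≤-trans (≤-reflexive (trans (List.length-++ (toList ρ)) (cong₂ _+_ (Vec.length-toList ρ)
        (trans (List.length-++ (toList ρ′)) (cong (_+ length (flat E)) (Vec.length-toList ρ′))))))
        (+-mono-≤ n≤q (+-mono-≤ n′≤q (flat-length short E≤q))))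

      named = naming vars vars-length
      name  = proj₁ named
      ω     = proj₁ (proj₂ named)

      fixed : ∀ {k} (σ : Vec (Fin (suc nv)) k) → (∀ {v} → v ∈ toList σ → v ∈ vars) → map ω (map name σ) ≡ σ
      fixed σ sub = trans (sym (Vec.map-∘ ω name σ)) (map-fixed (ω ∘ name) σ (proj₂ (proj₂ named) ∘ sub))

      rename : Constraint 𝔸 (suc nv) → Atom r
      rename (i , σ) = edbAtom (i , map name σ)

      renamed : ∀ {f : Fin r → Fin size} E → All (Holds f) (List.map rename E) →
        All (λ c → rel (proj₁ c) (map (f ∘ name) (proj₂ c)) ≡ true) E
      renamed []            []       = []
      renamed {f} ((i , σ) ∷ E) (h ∷ hs) = subst (λ t → rel i t ≡ true) (sym (Vec.map-∘ f name σ)) h ∷ renamed E hs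

      source target : Atom r
      source = inj₂ (n , R) , map name ρ
      target = inj₂ (n′ , R′) , map name ρ′

      equivᵒ : ∀ f → All (Holds f) (List.map rename E) → R (map f (map name ρ)) ≡ R′ (map f (map name ρ′))
      equivᵒ f hs = trans (cong R (sym (Vec.map-∘ f name ρ)))
        (trans (equiv (f ∘ name) (renamed E hs)) (cong R′ (Vec.map-∘ f name ρ′)))

      rule : Rule
      rule = record { nvars = r ; head = n′ , R′ ; headArgs = map name ρ′ ; body = source ∷ List.map rename E }

      countIDB-edb : ∀ E → countIDB (List.map rename E) ≡ 0
      countIDB-edb []      = refl
      countIDB-edb (_ ∷ E) = countIDB-edb E

      unique : ∀ {E} → length E ≤ 1 → Unique (source ∷ List.map rename E)
      unique {[]}         _ = [] ∷ []
      unique {_ ∷ []}     _ = ((λ ()) ∷ []) ∷ [] ∷ []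
      unique {_ ∷ _ ∷ _} (s≤s ())

      symmetric : IsSRule rule
      symmetric = refl , s≤s (≤-reflexive (countIDB-edb E)) , unique short ,
        (tt ∷ All.map⁺ (All.map (λ le → ≤-trans le q≤r) E≤q)) ,
        (λ { f (h ∷ hs) → trans (sym (equivᵒ f hs)) h }) ,
        λ { (_ , here refl) _ f (h ∷ hs) → trans (equivᵒ f hs) h
          ; (_ , there a∈) isIDB → ⊥-elim (notIDB a∈ isIDB) }
        where
        notIDB : ∀ {a} → a ∈ List.map rename E → ¬ IsIDBAtom a
        notIDB a∈ isIDB with ∈-map⁻ rename a∈
        ... | _ , _ , refl = isIDB

      edbs : ∀ {E′} → All (_∈ constraints) E′ → (∀ {c} → c ∈ E′ → c ∈ E) →
        All (λ a → Derives (proj₁ a) (map ω (proj₂ a))) (List.map rename E′)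
      edbs []                     _   = []
      edbs {(i , σ) ∷ _} (c∈ ∷ cs) sub =
        edb (subst (λ σ → (i , σ) ∈ constraints)
              (sym (fixed σ λ v∈ → ∈-++⁺ʳ (toList ρ) (∈-++⁺ʳ (toList ρ′) (∈-flat (sub (here refl)) v∈)))) c∈)
        ∷ edbs cs (sub ∘ there)

    -- Since `equiv` is an equality of truth values, the rule stays consistent when its head and its
    -- IDB atom are exchanged. An assignment of the names pulls back along `name` to the instance
    -- variables, where `equiv` applies.
    apply-rule : Derives (inj₂ (n , R)) ρ → Derives (inj₂ (n′ , R′)) ρ′
    apply-rule d = subst (Derives _) (fixed ρ′ (∈-++⁺ʳ (toList ρ) ∘ ∈-++⁺ˡ))
      (app rule symmetric ω (subst (Derives _) (sym (fixed ρ ∈-++⁺ˡ)) d ∷ edbs E⊆ id))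

  -- A predicate has its arity in `Fin (suc r)`, a formula in ℕ; `means` ties the two together by
  -- truth values instead of by an equality of tables.
  record Fact (F : Formula) : Set where
    field
      n     : Fin (suc r)
      n≤q   : toℕ n ≤ q
      ρ     : Vec (Fin (suc nv)) (toℕ n)
      R     : Vec (Fin size) (toℕ n) → Bool
      means : ∀ f → R (map f ρ) ≡ ⟦ F ⟧ f

  asFact : ∀ F → width F ≤ q → Fact F
  asFact (formula {m} ρ R) m≤q = go (fromℕ< (s≤s (≤-trans m≤q q≤r))) (Fin.toℕ-fromℕ< _) ρ R m≤q
    where
    go : ∀ (n : Fin (suc r)) {m} → toℕ n ≡ m → (ρ : Vec (Fin (suc nv)) m) (R : Vec (Fin size) m → Bool) →
      m ≤ q → Fact (formula ρ R)
    go n refl ρ R m≤q = record { n = n ; n≤q = m≤q ; ρ = ρ ; R = R ; means = λ _ → refl }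

  Derived : Formula → Set
  Derived F = Σ (Fact F) λ φ → Derives (inj₂ (Fact.n φ , Fact.R φ)) (Fact.ρ φ)

  by-equivalence : ∀ {F G} → width G ≤ q → (∀ f → ⟦ F ⟧ f ≡ ⟦ G ⟧ f) → Derived F → Derived G
  by-equivalence {F} {G} G≤q eq (φ , d) = ψ , apply-rule (Fact.ρ φ) (Fact.R φ) (Fact.ρ ψ) (Fact.R ψ) [] [] z≤n
    (Fact.n≤q φ) (Fact.n≤q ψ) [] (λ f _ → trans (Fact.means φ f) (trans (eq f) (sym (Fact.means ψ f)))) d
    where ψ = asFact G G≤q

  by-constraint : ∀ {F G c} → c ∈ constraints → width (atom c) ≤ q → width G ≤ q →
    (∀ f → f ⊨ atom c → ⟦ F ⟧ f ≡ ⟦ G ⟧ f) → Derived F → Derived G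
  by-constraint {F} {G} {c} c∈ c≤q G≤q eq (φ , d) = ψ , apply-rule (Fact.ρ φ) (Fact.R φ) (Fact.ρ ψ) (Fact.R ψ)
    (c ∷ []) (c∈ ∷ []) (s≤s z≤n) (Fact.n≤q φ) (Fact.n≤q ψ) (c≤q ∷ [])
    (λ { f (h ∷ _) → trans (Fact.means φ f) (trans (eq f h) (sym (Fact.means ψ f))) }) d
    where ψ = asFact G G≤q

  -- Both directions are proved at once because `flip` exchanges them.
  transfer : ∀ {F G} → q ⊢ F ≈ G → (Derived F → Derived G) × (Derived G → Derived F)
  transfer (local p q e) = by-equivalence q e , by-equivalence p (sym ∘ e)
  transfer (adjoin {F} {c} c∈ le) =
    by-constraint c∈ c≤q le (λ f h → absorbed f h) ,
    by-constraint c∈ c≤q (m+n≤o⇒m≤o (width F) le) (λ f h → sym (absorbed f h))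
    where
    c≤q = m+n≤o⇒n≤o (width F) le
    absorbed : ∀ f → f ⊨ atom c → ⟦ F ⟧ f ≡ ⟦ F ⩓ atom c ⟧ f
    absorbed f h = trans (∧-absorb (⟦ F ⟧ f) (λ _ → h)) (sym (⟦⩓⟧ F (atom c) f))
  transfer (flip d) = let to , from = transfer d in from , to
  transfer (d ⨾ e)  = let to , from = transfer d ; to′ , from′ = transfer e in to′ ∘ to , from ∘ from′

  derived-𝕋 : Derived 𝕋
  derived-𝕋 = record { n = Fin.zero ; n≤q = z≤n ; ρ = [] ; R = λ _ → true ; means = λ _ → refl } ,
    app (record { nvars = r ; head = Fin.zero , (λ _ → true) ; headArgs = [] ; body = [] })
      (refl , z≤n , [] , [] , (λ _ _ → refl) , λ ()) (λ _ → Fin.zero) []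

  derive-goal : ∀ {F} → q ⊢ F → (∀ f → ¬ f ⊨ F) → DerivesGoal IsSRule IsSGoal I
  derive-goal {F} d unsat =
    let φ , e = proj₁ (transfer d) derived-𝕋
    in inj₂ (Fin.zero , λ _ → false) , [] , (λ _ → refl) ,
       apply-rule (Fact.ρ φ) (Fact.R φ) [] (λ _ → false) [] [] z≤n (Fact.n≤q φ) z≤n []
         (λ f _ → Bool.¬-not (unsat f ∘ trans (sym (Fact.means φ f)))) e

-- Paths of bags

module _ {A : Set} (g : A → ℕ) where

  supremum : List A → ℕ
  supremum []       = 0
  supremum (x ∷ xs) = g x ⊔ supremum xs

  ≤-supremum : ∀ {x xs} → x ∈ xs → g x ≤ supremum xs
  ≤-supremum {xs = y ∷ ys} (here refl) = m≤m⊔n (g y) (supremum ys)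
  ≤-supremum {xs = y ∷ ys} (there x∈) = ≤-trans (≤-supremum x∈) (m≤n⊔m (g y) (supremum ys))

lastOf-applyUpTo : ∀ {A : Set} (f : ℕ → A) n → lastOf (f 0) (applyUpTo (f ∘ suc) n) ≡ f n
lastOf-applyUpTo f zero    = refl
lastOf-applyUpTo f (suc n) = lastOf-applyUpTo (f ∘ suc) n

funToFin-cong : ∀ {m n} {f g : Fin m → Fin n} → (∀ i → f i ≡ g i) → funToFin f ≡ funToFin g
funToFin-cong {zero}  eq = refl
funToFin-cong {suc m} eq = cong₂ combine (eq Fin.zero) (funToFin-cong (eq ∘ Fin.suc))

apply3-map : ∀ 𝔸 (p : Op3 𝔸) {m k} (α β γ : Fin m → Fin (Structure.size 𝔸)) (σ : Vec (Fin m) k) →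
  map (λ j → p (α j) (β j) (γ j)) σ ≡ apply3 𝔸 p (map α σ) (map β σ) (map γ σ)
apply3-map 𝔸 p α β γ []      = refl
apply3-map 𝔸 p α β γ (_ ∷ σ) = cong (_ ∷_) (apply3-map 𝔸 p α β γ σ)

-- Products and powers of matrices between bags

module Bags (𝔸 : Structure) {n : ℕ} (p : Fin (suc n) → Op3 𝔸) (chain : IsHMChain 𝔸 n p) (w : ℕ) where

  open Structure 𝔸

  N : ℕ
  N = size ^ w

  enc : (Fin w → Fin size) → Fin N
  enc = funToFin

  dec : Fin N → Fin w → Fin size
  dec = finToFun

  dec-enc : ∀ f j → dec (enc f) j ≡ f j
  dec-enc = Fin.finToFun-funToFin

  enc-dec : ∀ a → enc (dec a) ≡ a
  enc-dec = Fin.funToFin-finToFin {w} {size}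

  enc-cong : ∀ {f g} → (∀ j → f j ≡ g j) → enc f ≡ enc g
  enc-cong = funToFin-cong

  pᴺ : Fin (suc n) → Fin N → Fin N → Fin N → Fin N
  pᴺ i a b c = enc λ j → p i (dec a j) (dec b j) (dec c j)

  Compatible : BoolMatrix N → Set
  Compatible M = ∀ i → Preserves (pᴺ i) (Entry M)

  𝟙-compatible : Compatible 𝟙
  𝟙-compatible i aa bb cc with 𝟙⁻ aa | 𝟙⁻ bb | 𝟙⁻ cc
  ... | refl | refl | refl = 𝟙⁺

  ⊙-compatible : ∀ {M M′} → Compatible M → Compatible M′ → Compatible (M ⊙ M′)
  ⊙-compatible {M} {M′} cM cM′ i p q r =
    let _ , p₁ , p₂ = ⊙⁻ M M′ p
        _ , q₁ , q₂ = ⊙⁻ M M′ q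
        _ , r₁ , r₂ = ⊙⁻ M M′ r
    in ⊙⁺ M M′ (cM i p₁ q₁ r₁) (cM′ i p₂ q₂ r₂)

  open HagemannMitschke pᴺ
    (λ x y z → trans (enc-cong λ j → proj₁ chain (dec x j) (dec y j) (dec z j)) (enc-dec x))
    (λ i x y → enc-cong λ j → proj₁ (proj₂ chain) i (dec x j) (dec y j))
    (λ x y z → trans (enc-cong λ j → proj₂ (proj₂ chain) (dec x j) (dec y j) (dec z j)) (enc-dec z))

  module _ {e : BoolMatrix N} (idem : e ⊙ e ≡ e) where

    idempotent-trans : Transitive (Entry e)
    idempotent-trans {a} {b} {c} ab bc = subst (λ M → Entry M a c) idem (⊙⁺ e e ab bc)

    idempotent-retract : Compatible e → ∀ {x s t u v} →
      Entry e s t → Entry e t u → Entry e u v → Entry e x u → Entry e x t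
    idempotent-retract comp = retract {E = Entry e} idempotent-trans
      -- Density of e is its idempotence read from right to left.
      (λ {x} {y} xy → ⊙⁻ e e (subst (λ M → Entry M x y) (sym idem) xy))
      (symmetric-on-loops {Entry e} comp idempotent-trans)

  module Derivability {nv : ℕ} (I : Instance 𝔸 nv) where

    open Formulas 𝔸 I

    Bag : Set
    Bag = Fin w → Fin nv

    W : ℕ
    W = w + w

    between : BoolMatrix N → Bag → Bag → Formula
    between M x y = formula (tabulate x Vec.++ tabulate y)
      λ t → entry M (enc (lookup (take w t))) (enc (lookup (drop w t)))

    ⟦between⟧ : ∀ M x y f → ⟦ between M x y ⟧ f ≡ entry M (enc (f ∘ x)) (enc (f ∘ y))
    ⟦between⟧ M x y f rewrite Vec.map-++ f (tabulate x) (tabulate y)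
      | take-++ (map f (tabulate x)) (map f (tabulate y))
      | drop-++ (map f (tabulate x)) (map f (tabulate y)) =
      cong₂ (entry M) (lookup-bag x) (lookup-bag y)
      where
      lookup-bag : ∀ x → enc (lookup (map f (tabulate x))) ≡ enc (f ∘ x)
      lookup-bag x = enc-cong λ j →
        trans (Vec.lookup-map j f (tabulate x)) (cong f (Vec.lookup∘tabulate x j))

    ⊨-between⁻ : ∀ {M x y f} → f ⊨ between M x y → Entry M (enc (f ∘ x)) (enc (f ∘ y))
    ⊨-between⁻ {M} {x} {y} {f} = trans (sym (⟦between⟧ M x y f))

    ⊨-between⁺ : ∀ {M x y f} → Entry M (enc (f ∘ x)) (enc (f ∘ y)) → f ⊨ between M x y
    ⊨-between⁺ {M} {x} {y} {f} = trans (⟦between⟧ M x y f)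

    compose : ∀ {q q′} M M′ {x y z} → q ⊢ between M x y → q ⊢ between M′ y z → q + W + W ≤ q′ →
      q′ ⊢ between (M ⊙ M′) x z
    compose M M′ {x} {y} {z} d e le = weaken le (deduce (between (M ⊙ M′) x z) (conjoin d e) λ f h →
      let h₁ , h₂ = ⊨-⩓⁻ (between M x y) (between M′ y z) h
      in ⊨-between⁺ {M ⊙ M′} {x} {z} (⊙⁺ M M′ (⊨-between⁻ {M} {x} {y} h₁) (⊨-between⁻ {M′} {y} {z} h₂)))

    module _ {e : BoolMatrix N} (idem : e ⊙ e ≡ e) (comp : Compatible e) where

      -- From t to u transitivity suffices; the way back is `idempotent-retract`, which needs the
      -- edges before and after tu. The cost 3W is two conjunctions and one replacement.
      slide : ∀ {q} x₀ s t u v → q ⊢ between e s t → q ⊢ between e t u → q ⊢ between e u v →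
        (q + W + W + W) ⊢ between e x₀ t ≈ between e x₀ u
      slide {q} x₀ s t u v st tu uv =
        replace (conjoin (conjoin st tu) (weaken (m≤m+n q W) uv)) refl refl λ f h →
          let h₁ , h₂ = ⊨-⩓⁻ (between e s t ⩓ between e t u) (between e u v) h
              h₃ , h₄ = ⊨-⩓⁻ (between e s t) (between e t u) h₁
              st′ = ⊨-between⁻ {e} {s} {t} h₃
              tu′ = ⊨-between⁻ {e} {t} {u} h₄
              uv′ = ⊨-between⁻ {e} {u} {v} h₂
          in ≡true-ext
            (λ k → ⊨-between⁺ {e} {x₀} {u} (idempotent-trans idem (⊨-between⁻ {e} {x₀} {t} k) tu′))
            (λ k → ⊨-between⁺ {e} {x₀} {t} (idempotent-retract idem comp st′ tu′ uv′ (⊨-between⁻ {e} {x₀} {u} k)))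

      -- The slides are chained by `_⨾_`, so the width q + 3W does not grow with the length of the
      -- power. The last edge has no successor to slide with and is composed instead, for another
      -- 2W.
      iterate : ∀ {q} (x : ℕ → Bag) i s t is → q ⊢ between e (x s) (x t) →
        (q + W + W + W) ⊢ between e (x i) (x t) →
        Linked (λ j k → q ⊢ between e (x j) (x k)) (t ∷ is) →
        (q + W + W + W + W + W) ⊢ between e (x i) (x (lastOf t is))
      iterate x i s t .[] st it [-] = weaken (≤-trans (m≤m+n _ W) (m≤m+n _ W)) it
      iterate {q} x i s t (u ∷ .[]) st it (tu ∷ [-]) =
        subst (λ M → _ ⊢ between M (x i) (x u)) idem
          (compose e e it (weaken (≤-trans (m≤m+n q W) (≤-trans (m≤m+n _ W) (m≤m+n _ W))) tu) ≤-refl)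
      iterate x i s t (u ∷ v ∷ is) st it (tu ∷ uv ∷ l) =
        iterate x i t u (v ∷ is) tu (it ⨾ slide (x i) (x s) (x t) (x u) (x v) st tu uv) (uv ∷ l)

    open Factorization (_≟ᴹ_ {N}) _⊙_ using (System)

    -- Each height costs 5W, the price of `iterate`; a binary product takes only 2W of it.
    level : ℕ → ℕ → ℕ
    level q₀ h = q₀ + h * (5 * W)

    level-suc : ∀ q₀ h → level q₀ h + W + W + W + W + W ≡ level q₀ (suc h)
    level-suc q₀ h = arithmetic q₀ h W
      where
      arithmetic : ∀ q₀ h W → q₀ + h * (5 * W) + W + W + W + W + W ≡ q₀ + suc h * (5 * W)
      arithmetic = solve-∀

    level-mono : ∀ q₀ {h h′} → h ≤ h′ → level q₀ h ≤ level q₀ h′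
    level-mono q₀ le = +-monoʳ-≤ q₀ (*-monoˡ-≤ (5 * W) le)

    system : ∀ q₀ → W ≤ q₀ → (x : ℕ → Bag) (L : ℕ → BoolMatrix N) → (∀ t → Compatible (L t)) → System
    system q₀ W≤q₀ x L comp = record
      { val     = val L
      ; val-∙   = λ {i} {j} {k} → val-⊙ L {i} {j} {k}
      ; Der     = Der
      ; mono    = weaken ∘ level-mono q₀
      ; empty   = λ {h} {i} → here-true h i
      ; concat  = λ {h} {i} {j} {k} i≤j j≤k d e →
          subst (λ M → level q₀ (suc h) ⊢ between M (x i) (x k)) (val-⊙ L {i} {j} {k} i≤j j≤k)
          (compose (val L i j) (val L j k) d e
            (≤-trans (≤-trans (m≤m+n _ W) (≤-trans (m≤m+n _ W) (m≤m+n _ W))) (≤-reflexive (level-suc q₀ h))))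
      ; iterate = λ {h} {e} {i} {is} → iterated {h} {e} {i} {is}
      }
      where
      Der : ℕ → ℕ → ℕ → Set
      Der h i j = level q₀ h ⊢ between (val L i j) (x i) (x j)

      val-diagonal : ∀ (L : ℕ → BoolMatrix N) i → val L i i ≡ 𝟙
      val-diagonal L zero    = refl
      val-diagonal L (suc i) = val-diagonal (L ∘ suc) i

      here-true : ∀ h i → Der h i i
      here-true h i = local z≤n (≤-trans W≤q₀ (m≤m+n q₀ _)) λ f →
        sym (⊨-between⁺ {val L i i} {x i} {x i}
          (subst (λ M → Entry M (enc (f ∘ x i)) (enc (f ∘ x i))) (sym (val-diagonal L i)) 𝟙⁺))

      iterated : ∀ {h e i is} → e ⊙ e ≡ e →
        Linked (λ j k → j ≤ k × val L j k ≡ e × Der h j k) (i ∷ is) → Der (suc h) i (lastOf i is)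
      iterated {h} {i = i} _ [-] = here-true (suc h) i
      iterated {h} {e} {i} {t ∷ is} idem chain@((_ , refl , d) ∷ ds) =
        subst (λ M → level q₀ (suc h) ⊢ between M (x i) (x (lastOf t is))) (sym (all-e chain))
          (weaken (≤-reflexive (level-suc q₀ h))
            -- The first link serves twice: as the edge into t and as the relation between the start
            -- and t.
            (iterate idem comp-e x i i t is d (weaken (≤-trans (m≤m+n _ W) (≤-trans (m≤m+n _ W) (m≤m+n _ W))) d)
              (Linked.map (λ {j} {k} (_ , eq , d) → subst (λ M → _ ⊢ between M (x j) (x k)) eq d) ds)))
        where
        comp-e : Compatible (val L i t)
        comp-e = val-preserves {P = Compatible} 𝟙-compatible (λ {M} {M′} → ⊙-compatible {M} {M′}) {L} comp i t
        all-e : ∀ {i t is} → Linked (λ j k → j ≤ k × val L j k ≡ e × Der h j k) (i ∷ t ∷ is) →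
          val L i (lastOf t is) ≡ e
        all-e ((_ , eq , _) ∷ [-]) = eq
        all-e {i} {t} {u ∷ is} ((i≤t , eq , _) ∷ l) =
          trans (sym (val-⊙ L {i} {t} {lastOf u is} i≤t (lastOf-≤ (Linked.map proj₁ l))))
            (trans (cong₂ _⊙_ eq (all-e l)) idem)

-- Linear derivations as paths of bags

module Traces (𝔸 : Structure) {n : ℕ} (p : Fin (suc n) → Op3 𝔸) (chain : IsHMChain 𝔸 n p)
  (poly : ∀ i → IsPolymorphism3 𝔸 (p i)) (P : Program 𝔸) (linear : IsLinearProgram 𝔸 P) where

  open Structure 𝔸
  open Program P

  InProgram : Rule → Set
  InProgram ρ = ρ ∈ rules

  allConstraints : List (Constraint 𝔸 size)
  allConstraints = concatMap (λ i → List.map (i ,_) (vectors (allFin size) (arity i))) (allFin nRel)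

  ∈-allConstraints : ∀ c → c ∈ allConstraints
  ∈-allConstraints (i , t) = ∈-concatMap⁺ _ (lose (∈-allFin i) (∈-map⁺ (i ,_) (∈-vectors ∈-allFin t)))

  valid? : ∀ (c : Constraint 𝔸 size) → Dec (rel (proj₁ c) (proj₂ c) ≡ true)
  valid? (i , t) = rel i t Bool.≟ true

  -- Serves in place of the unfolding of a derivation into an instance of its own.
  canonical : Instance 𝔸 size
  canonical = record { constraints = filter valid? allConstraints }

  canonical-satisfiable : Satisfiable 𝔸 canonical
  canonical-satisfiable = id , All.map (λ {c} → subst (λ t → rel (proj₁ c) t ≡ true) (sym (Vec.map-id (proj₂ c))))
    (All.all-filter valid? allConstraints)

  ∈-canonical : ∀ {i t} → rel i t ≡ true → (i , t) ∈ Instance.constraints canonical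
  ∈-canonical = ∈-filter⁺ valid? (∈-allConstraints _)

  module Canonical = Run InProgram canonical

  EDBHolds : ∀ {m} → (Fin m → Fin size) → Atom m → Set
  EDBHolds g (inj₁ i , σ) = rel i (map g σ) ≡ true
  EDBHolds g (inj₂ _ , _) = ⊤

  edbHolds? : ∀ {m} (g : Fin m → Fin size) a → Dec (EDBHolds g a)
  edbHolds? g (inj₁ i , σ) = rel i (map g σ) Bool.≟ true
  edbHolds? g (inj₂ _ , _) = yes tt

  EDBHolds-cong : ∀ {m} {g g′ : Fin m → Fin size} → (∀ j → g j ≡ g′ j) → ∀ a → EDBHolds g a → EDBHolds g′ a
  EDBHolds-cong eq (inj₁ i , σ) = subst (λ t → rel i t ≡ true) (Vec.map-cong eq σ)
  EDBHolds-cong eq (inj₂ _ , _) = id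

  EDBHolds-poly : ∀ {m} i {α β γ : Fin m → Fin size} a → EDBHolds α a → EDBHolds β a → EDBHolds γ a →
    EDBHolds (λ j → p i (α j) (β j) (γ j)) a
  EDBHolds-poly i {α} {β} {γ} (inj₁ k , σ) hα hβ hγ =
    subst (λ t → rel k t ≡ true) (sym (apply3-map 𝔸 (p i) α β γ σ)) (poly i k _ _ _ hα hβ hγ)
  EDBHolds-poly i (inj₂ _ , _) _ _ _ = tt

  edbSize : ∀ {m} → List (Atom m) → ℕ
  edbSize []                  = 0
  edbSize ((inj₁ i , _) ∷ as) = edbSize as + arity i
  edbSize ((inj₂ _ , _) ∷ as) = edbSize as

  w : ℕ
  w = supremum Rule.nvars rules

  -- The first supremum covers the constraints used by one rule application, the second a goal
  -- predicate that is a basic relation.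
  edbBound : ℕ
  edbBound = supremum (λ ρ → edbSize (Rule.body ρ)) rules ⊔ supremum arity (allFin nRel)

  q₀ : ℕ
  q₀ = edbBound + (w + w)

  open Bags 𝔸 p chain w

  OnlyIDB : ∀ {m} → Atom m → Atom m → Set
  OnlyIDB b a = IsIDBAtom a → a ≡ b

  module _ {m} (body : List (Atom m)) {k} (m≤w : m ≤ w) (μ μ′ : Vec (Fin w) k) where

    -- Here a evaluates the bag of a rule and b the bag of the rule that derived its IDB atom. The
    -- positions μ hold the arguments of that atom, and μ′ those of the head that produced it.
    Transition : Fin N → Fin N → Set
    Transition a b = All (EDBHolds (λ j → dec a (inject≤ j m≤w))) body × map (dec a) μ ≡ map (dec b) μ′

    transition? : ∀ a b → Dec (Transition a b)
    transition? a b = all? (edbHolds? _) body ×-dec Vec.≡-dec Fin._≟_ (map (dec a) μ) (map (dec b) μ′)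

    transition : BoolMatrix N
    transition = fromDec transition?

    -- A transition is a conjunction of basic relations and equalities of coordinates, and
    -- polymorphisms preserve both.
    transition-compatible : Compatible transition
    transition-compatible i {a} {b} {c} {a′} {b′} {c′} ab bb cc =
      let h₁ , e₁ = fromDec⁻ transition? ab
          h₂ , e₂ = fromDec⁻ transition? bb
          h₃ , e₃ = fromDec⁻ transition? cc
      in fromDec⁺ transition?
        ( All.zipWith (λ {x} (h₁ , h₂ , h₃) → EDBHolds-cong (λ j → sym (dec-enc _ (inject≤ j m≤w))) x
            (EDBHolds-poly i x h₁ h₂ h₃)) (h₁ , All.zip (h₂ , h₃))
        , trans (decode a b c μ) (trans
            (trans (cong₂ (λ x y → apply3 𝔸 (p i) x y (map (dec c) μ)) e₁ e₂)
                   (cong (apply3 𝔸 (p i) (map (dec a′) μ′) (map (dec b′) μ′)) e₃))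
            (sym (decode a′ b′ c′ μ′))))
      where
      decode : ∀ a b c μ → map (dec (pᴺ i a b c)) μ ≡
        apply3 𝔸 (p i) (map (dec a) μ) (map (dec b) μ) (map (dec c) μ)
      decode a b c μ = trans (Vec.map-cong (dec-enc _) μ) (apply3-map 𝔸 (p i) (dec a) (dec b) (dec c) μ)

  module OnInstance {nv : ℕ} (I : Instance 𝔸 (suc nv)) where

    open Instance I
    open Formulas 𝔸 I
    open Derivability I
    open Run InProgram I

    -- A derivation of R(τ), read from the derived fact back to its leaf, as a path of bags.
    record Trace (R : Fin nIDB) (τ : Vec (Fin (suc nv)) (idbArity R)) : Set where
      field
        steps      : ℕ
        bag        : ℕ → Bag
        letter     : ℕ → BoolMatrix N
        compatible : ∀ t → Compatible (letter t)
        derivable  : ∀ {t} → t < steps → q₀ ⊢ between (letter t) (bag t) (bag (suc t))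
        position   : Vec (Fin w) (idbArity R)
        located    : map (bag 0) position ≡ τ
        models     : ∀ {a b} → Entry (val letter 0 steps) a b → Canonical.Derives (inj₂ R) (map (dec a) position)

    Traced : (q : Pred) → Vec (Fin (suc nv)) (predArity q) → Set
    Traced (inj₁ i) σ = (i , σ) ∈ constraints
    Traced (inj₂ R) τ = Trace R τ

    module _ {m} (ω : Fin m → Fin (suc nv)) where

      edbs : List (Atom m) → Formula
      edbs []                  = 𝕋
      edbs ((inj₁ i , σ) ∷ as) = edbs as ⩓ atom (i , map ω σ)
      edbs ((inj₂ _ , _) ∷ as) = edbs as

      width-edbs : ∀ as → width (edbs as) ≡ edbSize as
      width-edbs []                  = refl
      width-edbs ((inj₁ i , _) ∷ as) = cong (_+ arity i) (width-edbs as)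
      width-edbs ((inj₂ _ , _) ∷ as) = width-edbs as

      ⊨-edbs : ∀ {f} as → f ⊨ edbs as → All (EDBHolds (f ∘ ω)) as
      ⊨-edbs []                  _ = []
      ⊨-edbs {f} ((inj₁ i , σ) ∷ as) h =
        let h₁ , h₂ = ⊨-⩓⁻ (edbs as) (atom (i , map ω σ)) h
        in subst (λ t → rel i t ≡ true) (sym (Vec.map-∘ f ω σ)) h₂ ∷ ⊨-edbs as h₁
      ⊨-edbs ((inj₂ _ , _) ∷ as) h = tt ∷ ⊨-edbs as h

      derive-edbs : ∀ as → All (λ a → Traced (proj₁ a) (map ω (proj₂ a))) as → edbSize as ⊢ edbs as
      derive-edbs []                  []       = local z≤n z≤n λ _ → refl
      derive-edbs ((inj₁ i , _) ∷ as) (c∈ ∷ ts) =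
        weaken (m≤m+n _ (arity i)) (derive-edbs as ts) ⨾
        adjoin c∈ (≤-reflexive (cong (_+ arity i) (width-edbs as)))
      derive-edbs ((inj₂ _ , _) ∷ as) (_ ∷ ts) = derive-edbs as ts

    idbView : ∀ {m} {ω : Fin m → Fin (suc nv)} {as : List (Atom m)} → countIDB as ≤ 1 →
      All (λ a → Traced (proj₁ a) (map ω (proj₂ a))) as →
      All (¬_ ∘ IsIDBAtom) as ⊎
      Σ (Fin nIDB) λ R → Σ (Vec (Fin m) (idbArity R)) λ σ →
        Trace R (map ω σ) × All (OnlyIDB (inj₂ R , σ)) as
    idbView {as = []} _ [] = inj₁ []
    idbView {as = (inj₁ _ , _) ∷ _} c (_ ∷ ts) with idbView c ts
    ... | inj₁ none              = inj₁ (id ∷ none)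
    ... | inj₂ (R , σ , t , one) = inj₂ (R , σ , t , ((λ ()) ∷ one))
    idbView {as = (inj₂ R , σ) ∷ as} (s≤s c) (t ∷ _) =
      inj₂ (R , σ , t , (λ _ → refl) ∷ All.map (λ ¬idb → ⊥-elim ∘ ¬idb) (noIDB as c))
      where
      noIDB : ∀ {m} (as : List (Atom m)) → countIDB as ≤ 0 → All (¬_ ∘ IsIDBAtom) as
      noIDB []                  _ = []
      noIDB ((inj₁ _ , _) ∷ as) c = id ∷ noIDB as c

    module Extend (ρ : Rule) (ρ∈ : ρ ∈ rules) (ω : Fin (Rule.nvars ρ) → Fin (suc nv))
      (ts : All (λ a → Traced (proj₁ a) (map ω (proj₂ a))) (Rule.body ρ)) where

      open Rule ρ

      nvars≤w : nvars ≤ w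
      nvars≤w = ≤-supremum Rule.nvars ρ∈

      embed : Fin nvars → Fin w
      embed j = inject≤ j nvars≤w

      padded : Bag
      padded i with toℕ i <? nvars
      ... | yes lt = ω (fromℕ< lt)
      -- Slots beyond the variables of the rule get a dummy; transitions read only embedded
      -- positions.
      ... | no _   = Fin.zero

      padded-embed : ∀ j → padded (embed j) ≡ ω j
      padded-embed j with toℕ (embed j) <? nvars
      ... | yes lt = cong ω (Fin.toℕ-injective (trans (Fin.toℕ-fromℕ< lt) (Fin.toℕ-inject≤ j nvars≤w)))
      ... | no ≮   = contradiction (subst (_< nvars) (sym (Fin.toℕ-inject≤ j nvars≤w)) (Fin.toℕ<n j)) ≮

      map-padded : ∀ {k} (σ : Vec (Fin nvars) k) → map padded (map embed σ) ≡ map ω σ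
      map-padded σ = trans (sym (Vec.map-∘ padded embed σ)) (Vec.map-cong padded-embed σ)

      module _ {k} (μ μ′ : Vec (Fin w) k) (next : Bag) (agree : map padded μ ≡ map next μ′) where

        first : BoolMatrix N
        first = transition body nvars≤w μ μ′

        first-derivable : q₀ ⊢ between first padded next
        first-derivable = weaken (+-monoˡ-≤ W (≤-trans (≤-supremum (λ ρ → edbSize (Rule.body ρ)) ρ∈) (m≤m⊔n _ _)))
          (deduce (between first padded next) (derive-edbs ω body ts) λ f h →
            ⊨-between⁺ {first} {padded} {next} (fromDec⁺ (transition? body nvars≤w μ μ′)
              ( All.map (λ {a} → EDBHolds-cong (λ j → sym (trans (dec-enc _ (embed j)) (cong f (padded-embed j)))) a)
                  (⊨-edbs ω body h)
              , trans (decode f padded μ) (trans (cong (map f) agree) (sym (decode f next μ′))))))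
          where
          decode : ∀ f x (μ : Vec (Fin w) k) → map (dec (enc (f ∘ x))) μ ≡ map f (map x μ)
          decode f x μ = trans (Vec.map-cong (dec-enc _) μ) (Vec.map-∘ f x μ)

      apply-canonical : ∀ a → All (EDBHolds (dec a ∘ embed)) body →
        (All (λ x → IsIDBAtom x → Canonical.Derives (proj₁ x) (map (dec a ∘ embed) (proj₂ x))) body) →
        Canonical.Derives (inj₂ head) (map (dec a) (map embed headArgs))
      apply-canonical a hs ds = subst (Canonical.Derives (inj₂ head)) (Vec.map-∘ (dec a) embed headArgs)
        (Canonical.app ρ ρ∈ (dec a ∘ embed) (All.zipWith (λ {x} → premise x) (hs , ds)))
        where
        premise : ∀ x → EDBHolds (dec a ∘ embed) x ×
          (IsIDBAtom x → Canonical.Derives (proj₁ x) (map (dec a ∘ embed) (proj₂ x))) →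
          Canonical.Derives (proj₁ x) (map (dec a ∘ embed) (proj₂ x))
        premise (inj₁ i , σ) (h , _) = Canonical.edb (∈-canonical h)
        premise (inj₂ R , σ) (_ , d) = d tt

      start : All (¬_ ∘ IsIDBAtom) body → Trace head (map ω headArgs)
      start none = record
        { steps      = 1
        ; bag        = λ _ → padded
        -- At a leaf there is no IDB atom to glue, so the equality of arguments is empty and any
        -- next bag would do.
        ; letter     = λ _ → first [] [] padded refl
        ; compatible = λ _ → transition-compatible body nvars≤w [] []
        ; derivable  = λ _ → first-derivable [] [] padded refl
        ; position   = map embed headArgs
        ; located    = map-padded headArgs
        ; models     = λ {a} e → let _ , e₁ , _ = ⊙⁻ (first [] [] padded refl) 𝟙 e in
            apply-canonical a (proj₁ (fromDec⁻ (transition? body nvars≤w [] []) e₁))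
              (All.map (λ ¬idb → ⊥-elim ∘ ¬idb) none)
        }

      extend : ∀ {R σ} → Trace R (map ω σ) → All (OnlyIDB (inj₂ R , σ)) body → Trace head (map ω headArgs)
      extend {R} {σ} tr one = record
        { steps      = suc steps
        ; bag        = bag′
        ; letter     = letter′
        ; compatible = λ { zero → transition-compatible body nvars≤w μ position ; (suc t) → compatible t }
        ; derivable  = λ { {zero} _ → first-derivable μ position (bag 0) agree ; {suc t} (s≤s lt) → derivable lt }
        ; position   = map embed headArgs
        ; located    = map-padded headArgs
        ; models     = models′
        }
        where
        open Trace tr
        μ = map embed σ
        agree : map padded μ ≡ map (bag 0) position
        agree = trans (map-padded σ) (sym located)
        bag′ : ℕ → Bag
        bag′ zero    = padded
        bag′ (suc t) = bag t
        letter′ : ℕ → BoolMatrix N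
        letter′ zero    = first μ position (bag 0) agree
        letter′ (suc t) = letter t
        models′ : ∀ {a b} → Entry (val letter′ 0 (suc steps)) a b →
          Canonical.Derives (inj₂ head) (map (dec a) (map embed headArgs))
        models′ {a} e =
          let c , e₁ , e₂ = ⊙⁻ (letter′ 0) (val letter 0 steps) e
              hs , eq     = fromDec⁻ (transition? body nvars≤w μ position) e₁
              -- The gluing equality turns the fact derived further down the path into the premise
              -- of this rule.
              d = subst (Canonical.Derives (inj₂ R)) (trans (sym eq) (sym (Vec.map-∘ (dec a) embed σ))) (models e₂)
          in apply-canonical a hs (All.map (λ isIt idb →
               subst (λ x → Canonical.Derives (proj₁ x) (map (dec a ∘ embed) (proj₂ x))) (sym (isIt idb)) d) one)

    trace  : ∀ {q τ} → Derives q τ → Traced q τ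
    traces : ∀ {m} {ω : Fin m → Fin (suc nv)} {as : List (Atom m)} →
      All (λ a → Derives (proj₁ a) (map ω (proj₂ a))) as → All (λ a → Traced (proj₁ a) (map ω (proj₂ a))) as

    trace (edb c∈) = c∈
    trace (app ρ ρ∈ ω ds) with traces ds
    ... | ts with idbView (All.lookup linear ρ∈) ts
    ...   | inj₁ none               = Extend.start ρ ρ∈ ω ts none
    ...   | inj₂ (_ , _ , tr , one) = Extend.extend ρ ρ∈ ω ts tr one

    traces []       = []
    traces (d ∷ ds) = trace d ∷ traces ds

  open Factorization (_≟ᴹ_ {N}) _⊙_ using (Bounded; bounded)

  abstract

    all-bounded : Bounded (matrices N)
    all-bounded = bounded (suc (length (matrices N))) (matrices N) ≤-refl

  height : ℕ
  height = proj₁ (all-bounded 0)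

  q : ℕ
  q = q₀ + height * (5 * (w + w))

  module _ (decides : ProgramDecides 𝔸 P) {nv : ℕ} (I : Instance 𝔸 (suc nv)) (unsat : ¬ Satisfiable 𝔸 I) where

    open Formulas 𝔸 I
    open Derivability I
    open SymmetricDerivations 𝔸 I q using (derive-goal)
    open OnInstance I
    open Symmetric 𝔸 (suc (q + (q + q))) using (IsSRule; IsSGoal) renaming (DerivesGoal to SymmetricDerivesGoal)

    no-canonical-goal : ∀ {x args} → goal x ≡ true → ¬ Canonical.Derives x args
    no-canonical-goal g d = proj₁ (decides size canonical) (_ , _ , g , d) canonical-satisfiable

    refute : SymmetricDerivesGoal IsSRule IsSGoal I
    refute with proj₂ (decides (suc nv) I) unsat
    -- A goal predicate may be a basic relation; then the path is replaced by a single constraint.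
    ... | inj₁ i , σ , g , d =
      derive-goal {F = 𝕋 ⩓ atom (i , σ)}
        (adjoin (trace d) (≤-trans (≤-supremum arity (∈-allFin i))
          (≤-trans (m≤n⊔m (supremum (λ ρ → edbSize (Rule.body ρ)) rules) _) (≤-trans (m≤m+n _ W) (m≤m+n q₀ _)))))
        λ f h → no-canonical-goal g (Canonical.edb (∈-canonical (proj₂ (⊨-⩓⁻ 𝕋 (atom (i , σ)) h))))
    ... | inj₂ R , τ , g , d =
      derive-goal {F = between (val letter 0 steps) (bag 0) (bag steps)} derived
        λ f h → no-canonical-goal g (models (⊨-between⁻ {val letter 0 steps} {bag 0} {bag steps} h))
      where
      open Trace (trace d)
      sys = system q₀ (m≤n+m W edbBound) bag letter compatible
      derived : q ⊢ between (val letter 0 steps) (bag 0) (bag steps)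
      derived = subst (λ t → q ⊢ between (val letter 0 t) (bag 0) (bag t)) (lastOf-applyUpTo id steps)
        (proj₂ (all-bounded 0) sys 0 (applyUpTo suc steps)
          (AllPairs.applyUpTo⁺₁ id (suc steps) λ i<j _ → <⇒≤ i<j , ∈-matrices _)
          (Linked.applyUpTo⁺₁ id (suc steps) λ { {t} (s≤s t<) →
            weaken (m≤m+n q₀ _) (subst (λ M → q₀ ⊢ between M (bag t) (bag (suc t)))
              (sym (val-step letter t)) (derivable t<)) }))

-- Padding and renaming need a default variable, so empty instances are treated apart: positive
-- arities leave them without constraints.
no-variables : ∀ 𝔸 (I : Instance 𝔸 0) → Satisfiable 𝔸 I
no-variables 𝔸 I = (λ ()) , All.universal (λ { (i , σ) → ⊥-elim (empty (Structure.arity-pos 𝔸 i) σ) }) _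
  where
  empty : ∀ {n} → NonZero n → ¬ Vec (Fin 0) n
  empty nz (() ∷ _)

theorem6 : (𝔸 : Structure) →
    (Σ (Program 𝔸) λ P → IsLinearProgram 𝔸 P × ProgramDecides 𝔸 P) →
    (Σ ℕ λ n → Σ (Fin (suc n) → Op3 𝔸) λ p →
    IsHMChain 𝔸 n p × ((i : Fin (suc n)) → IsPolymorphism3 𝔸 (p i))) →
    ∃ λ r → SymmetricDecides 𝔸 r
theorem6 𝔸 (P , linear , decides) (n , p , chain , poly) = r , λ where
    zero     I → goal-sound I , λ unsat → contradiction (no-variables 𝔸 I) unsat
    (suc nv) I → goal-sound I , refute decides I
  where
  open Traces 𝔸 p chain poly P linear
  r = suc (q + (q + q))
  goal-sound = λ {nv} (I : Instance 𝔸 nv) → SymmetricRun.goal-sound 𝔸 I r
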